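{- Let $p$ be a prime number, let $K$ be a field with embeddings into $\mathbb{R}$ and $\mathbb{Q}_p$, and let $\alpha\in K$ have property $I$. Let $p_n/q_n$ be the convergents of $\alpha$ obtained from the algorithm described in the context. Then, in $\mathbb{Q}_p$, $$\lim_{n\to\infty}\frac{p_n}{q_n}=\alpha_{\langle p\rangle}.$$
   Context: Let $p$ be a prime and $K$ a field with field embeddings $\sigma_\infty:K\to\mathbb{R}$ and $\sigma_p:K\to\mathbb{Q}_p$. For $\alpha\in K$ write $\alpha_\infty=\sigma_\infty(\alpha)$, $\alpha_{\langle p\rangle}=\sigma_p(\alpha)$. For $u=\sum_{n}c_np^n\in\mathbb{Q}_p$ with digits $c_n\in\{0,\dots,p-1\}$ ($c_n=0$ for $n<v_p(u)$), put $\lfloor u\rfloor_p=\sum_{n\le 0}c_np^n\in\mathbb{Z}[1/p]$. Property $I$: $\alpha_\infty\in(-\frac p2,\frac p2]$ and $v_p(\alpha_{\langle p\rangle})>0$. For $\alpha\in K^\times$ let $a^{(0)}(\alpha)=mp+\lfloor(1/\alpha)_{\langle p\rangle}\rfloor_p$, where $m$ is the smallest among the integers $i$ minimizing $|(1/\alpha)_\infty-ip-\lfloor(1/\alpha)_{\langle p\rangle}\rfloor_p|$; let $a^{(1)}(\alpha)=m'+\lfloor(1/\alpha)_{\langle p\rangle}\rfloor_p$, where $m'$ is the smallest among the integers $i$ minimizing $|(1/\alpha)_\infty-i-\lfloor(1/\alpha)_{\langle p\rangle}\rfloor_p|$. Put $T_{p,\epsilon}(\alpha)=\frac1\alpha-a^{(\epsilon)}(\alpha)$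 for $\epsilon\in\{0,1\}$. Algorithm: $\alpha_{(1)}=\alpha$; for $n\ge1$, if $\alpha_{(n)}\neq0$, set $\epsilon=0$ if $n$ is even, $\epsilon=1$ if $n$ is odd, $a_n(\alpha)=a^{(\epsilon)}(\alpha_{(n)})$ and $\alpha_{(n+1)}=T_{p,\epsilon}(\alpha_{(n)})$; if $\alpha_{(n)}=0$, terminate. Convergents: $p_0=0$, $q_0=1$, and for $n\ge1$ (as long as $a_n(\alpha)$ is defined) $$\begin{pmatrix} p_{n-1} & p_n \\ q_{n-1} & q_n \end{pmatrix}=\begin{pmatrix} 0 & 1 \\ 1 & a_1(\alpha) \end{pmatrix}\cdots\begin{pmatrix} 0 & 1 \\ 1 & a_n(\alpha) \end{pmatrix}.$$ One has $q_n\ne0$ for all such $n$. If the algorithm terminates, so that there are only finitely many convergents $p_0/q_0,\dots,p_N/q_N$, the limit is understood as the last convergent $p_N/q_N$. -}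

module Defs where

open import Level using (Level; _⊔_; 0ℓ) renaming (suc to lsuc)
open import Data.Nat.Base as ℕ using (ℕ; zero; suc; NonZero; parity)
import Data.Nat.Properties as ℕProps
open import Data.Nat.Primality using (Prime; prime⇒nonZero)
open import Data.Integer.Base as ℤ using (ℤ; +_; -[1+_])
open import Data.Integer.Divisibility.Signed using (_∣_; ∣-refl; ∣m∣n⇒∣m+n; ∣m⇒∣-m; ∣n⇒∣m*n; ∣m⇒∣m*n)
import Data.Integer.Properties as ℤProps
import Data.Integer.Solver as ℤSolver
open import Data.Parity.Base using (Parity; 0ℙ; 1ℙ)
open import Data.Rational.Unnormalised as ℚ using (ℚᵘ; mkℚᵘ; 0ℚᵘ; 1ℚᵘ; ½; _/_)
import Data.Rational.Unnormalised.Properties as ℚProps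
import Data.Rational.Unnormalised.Solver as ℚSolver
open import Data.Product.Base using (∃; ∃₂; Σ-syntax; _×_; _,_; proj₁)
open import Data.Unit.Base using (⊤; tt)
open import Algebra.Bundles using (CommutativeRing)
open import Algebra.Bundles.Raw using (RawRing)
import Algebra.Definitions.RawMonoid as RawMonoidDefs
open import Algebra.Morphism.Structures using (module RingMorphisms)
open import Relation.Binary.PropositionalEquality using (_≡_; refl; subst; sym)
open import Relation.Nullary.Negation using (¬_)

-- Inverses are required of every element that is not zero; equality is not
-- assumed decidable.
record Field (c ℓ : Level) : Set (lsuc (c ⊔ ℓ)) where
  field
    commutativeRing : CommutativeRing c ℓ

  open CommutativeRing commutativeRing public

  field
    0≉1        : ¬ (0# ≈ 1#)
    invertible : ∀ x → ¬ (x ≈ 0#) → ∃ λ y → x * y ≈ 1#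

  inv : ∀ x → ¬ (x ≈ 0#) → Carrier
  inv x x≉0 = proj₁ (invertible x x≉0)

  private
    open module Mult = RawMonoidDefs +-rawMonoid using () renaming (_×_ to _×ⁿ_)

  fromℤ : ℤ → Carrier
  fromℤ (+ n)    = n ×ⁿ 1#
  fromℤ -[1+ n ] = - (suc n ×ⁿ 1#)

------------------------------------------------------------------------
-- ℝ is the Cauchy completion of ℚ; order and equality are those of the limits.

module _ where
  open ℚ using (_+_; _*_; _-_; -_; ∣_∣; _<_; _≤_)

  record ℝ : Set where
    field
      term   : ℕ → ℚᵘ
      cauchy : ∀ ε → 0ℚᵘ < ε →
               ∃ λ N → ∀ m n → N ℕ.≤ m → N ℕ.≤ n → ∣ term m - term n ∣ < ε
  open ℝ public

  infix 4 _≈ℝ_ _<ℝ_ _≤ℝ_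

  _≈ℝ_ : ℝ → ℝ → Set
  x ≈ℝ y = ∀ ε → 0ℚᵘ < ε → ∃ λ N → ∀ n → N ℕ.≤ n → ∣ term x n - term y n ∣ < ε

  _<ℝ_ : ℝ → ℝ → Set
  x <ℝ y = ∃ λ ε → 0ℚᵘ < ε × ∃ λ N → ∀ n → N ℕ.≤ n → term x n + ε ≤ term y n

  _≤ℝ_ : ℝ → ℝ → Set
  x ≤ℝ y = ∀ ε → 0ℚᵘ < ε → ∃ λ N → ∀ n → N ℕ.≤ n → term x n ≤ term y n + ε

  private
    half>0 : ∀ {ε} → 0ℚᵘ < ε → 0ℚᵘ < ε * ½
    half>0 {ε} 0<ε = ℚProps.<-respˡ-≃ (ℚProps.*-zeroˡ ½) (ℚProps.*-monoˡ-<-pos ½ 0<ε)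

    halves : ∀ ε → ε * ½ + ε * ½ ℚ.≃ ε
    halves ε = ℚProps.≃-trans (ℚProps.≃-sym (ℚProps.*-distribˡ-+ ε ½ ½))
                 (ℚProps.≃-trans (ℚProps.*-congˡ {ε} (ℚ.*≡* refl)) (ℚProps.*-identityʳ ε))

    abs-swap : ∀ a b → ∣ a - b ∣ ℚ.≃ ∣ b - a ∣
    abs-swap a b = ℚProps.≃-trans (ℚProps.≃-sym (ℚProps.∣-p∣≃∣p∣ (a - b)))
      (ℚProps.∣-∣-cong (solve 2 (λ a b → :- (a :- b) := b :- a) ℚProps.≃-refl a b))
      where open ℚSolver.+-*-Solver

    abs-sum : ∀ {a b c δ ε} → a ℚ.≃ b + c → ∣ b ∣ < δ → ∣ c ∣ < ε → ∣ a ∣ < δ + ε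
    abs-sum {a} {b} {c} a≃ b< c< =
      ℚProps.≤-<-trans (ℚProps.≤-trans (ℚProps.≤-reflexive (ℚProps.∣-∣-cong a≃)) (ℚProps.∣p+q∣≤∣p∣+∣q∣ b c))
                   (ℚProps.+-mono-< b< c<)

    abs-halves : ∀ {a b c} ε → a ℚ.≃ b + c → ∣ b ∣ < ε * ½ → ∣ c ∣ < ε * ½ → ∣ a ∣ < ε
    abs-halves ε a≃ b< c< = ℚProps.<-respʳ-≃ (halves ε) (abs-sum a≃ b< c<)

    abs-triangle : ∀ a b → ∣ a ∣ ≤ ∣ a - b ∣ + ∣ b ∣
    abs-triangle a b = ℚProps.≤-trans
      (ℚProps.≤-reflexive (ℚProps.∣-∣-cong (solve 2 (λ a b → a := (a :- b) :+ b) ℚProps.≃-refl a b)))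
      (ℚProps.∣p+q∣≤∣p∣+∣q∣ (a - b) b)
      where open ℚSolver.+-*-Solver

    abs-diff : ∀ a b → ∣ a ∣ - ∣ b ∣ ≤ ∣ a - b ∣
    abs-diff a b = ℚProps.≤-trans (ℚProps.+-monoˡ-≤ (- ∣ b ∣) (abs-triangle a b))
      (ℚProps.≤-reflexive (solve 2 (λ c d → (c :+ d) :- d := c) ℚProps.≃-refl ∣ a - b ∣ ∣ b ∣))
      where open ℚSolver.+-*-Solver

    abs-< : ∀ {a ε} → a < ε → - a < ε → ∣ a ∣ < ε
    abs-< {mkℚᵘ (+ n) d}    a<ε _    = a<ε
    abs-< {mkℚᵘ -[1+ n ] d} _   -a<ε = -a<ε

    bounded : ∀ x → ∃₂ λ B N → 0ℚᵘ < B × (∀ n → N ℕ.≤ n → ∣ term x n ∣ < B)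
    bounded x with cauchy x 1ℚᵘ (ℚProps.positive⁻¹ 1ℚᵘ)
    ... | N , close = 1ℚᵘ + ∣ term x N ∣ , N
      , ℚProps.<-≤-trans (ℚProps.positive⁻¹ 1ℚᵘ)
          (ℚProps.p≤p+q 1ℚᵘ ∣ term x N ∣ {{ℚProps.∣-∣-nonNeg (term x N)}})
      , λ n N≤n → ℚProps.≤-<-trans (abs-triangle (term x n) (term x N))
          (ℚProps.+-monoˡ-< ∣ term x N ∣ (close n N N≤n ℕProps.≤-refl))

    -- If |a| < B and |b| < ε/B then |ab| < ε.
    abs-prod : ∀ {B} (0<B : 0ℚᵘ < B) → ∀ ε → 0ℚᵘ < ε → ∃ λ δ → 0ℚᵘ < δ ×
               (∀ a b → ∣ a ∣ < B → ∣ b ∣ < δ → ∣ a * b ∣ < ε)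
    abs-prod {B} 0<B ε 0<ε = δ , 0<δ , λ a b a<B b<δ →
      ℚProps.≤-<-trans (ℚProps.≤-trans (ℚProps.≤-reflexive (ℚProps.∣p*q∣≃∣p∣*∣q∣ a b))
                     (ℚProps.*-monoˡ-≤-nonNeg ∣ b ∣ {{ℚProps.∣-∣-nonNeg b}} (ℚProps.<⇒≤ a<B)))
                   (ℚProps.<-respʳ-≃ Bδ≃ε (ℚProps.*-monoʳ-<-pos B b<δ))
      where
      instance
        B-pos : ℚ.Positive B
        B-pos = ℚ.positive 0<B
        B≢0 : ℚ.NonZero B
        B≢0 = ℚProps.pos⇒nonZero B
        1/B-pos : ℚ.Positive (ℚ.1/ B)
        1/B-pos = ℚProps.1/pos⇒pos B
      δ : ℚᵘ
      δ = ε * ℚ.1/ B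
      0<δ : 0ℚᵘ < δ
      0<δ = ℚProps.<-respˡ-≃ (ℚProps.*-zeroˡ (ℚ.1/ B)) (ℚProps.*-monoˡ-<-pos (ℚ.1/ B) 0<ε)
      Bδ≃ε : B * δ ℚ.≃ ε
      Bδ≃ε = ℚProps.≃-trans
        (solve 3 (λ b e c → b :* (e :* c) := e :* (b :* c)) ℚProps.≃-refl B ε (ℚ.1/ B))
        (ℚProps.≃-trans (ℚProps.*-congˡ {ε} (ℚProps.*-inverseʳ B)) (ℚProps.*-identityʳ ε))
        where open ℚSolver.+-*-Solver

    left  : ∀ {a b n} → a ℕ.⊔ b ℕ.≤ n → a ℕ.≤ n
    left  {a} {b} = ℕProps.≤-trans (ℕProps.m≤m⊔n a b)

    right : ∀ {a b n} → a ℕ.⊔ b ℕ.≤ n → b ℕ.≤ n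
    right {a} {b} = ℕProps.≤-trans (ℕProps.m≤n⊔m a b)

  fromℚ : ℚᵘ → ℝ
  fromℚ q .term   _     = q
  fromℚ q .cauchy ε 0<ε = 0 , λ _ _ _ _ →
    ℚProps.<-respˡ-≃ (ℚProps.≃-sym (ℚProps.∣-∣-cong (ℚProps.+-inverseʳ q))) 0<ε

  infixl 6 _+ℝ_ _-ℝ_
  infixl 7 _*ℝ_
  infix  8 -ℝ_

  _+ℝ_ : ℝ → ℝ → ℝ
  (x +ℝ y) .term n = term x n + term y n
  (x +ℝ y) .cauchy ε 0<ε with cauchy x (ε * ½) (half>0 0<ε) | cauchy y (ε * ½) (half>0 0<ε)
  ... | M , p | N , q = M ℕ.⊔ N , λ m n M≤ N≤ → abs-halves ε
    (solve 4 (λ a b c d → (a :+ b) :- (c :+ d) := (a :- c) :+ (b :- d)) ℚProps.≃-refl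
      (term x m) (term y m) (term x n) (term y n))
    (p m n (left M≤) (left N≤)) (q m n (right M≤) (right N≤))
    where open ℚSolver.+-*-Solver

  -ℝ_ : ℝ → ℝ
  (-ℝ x) .term n = - term x n
  (-ℝ x) .cauchy ε 0<ε with cauchy x ε 0<ε
  ... | N , p = N , λ m n N≤m N≤n → ℚProps.<-respˡ-≃
    (ℚProps.∣-∣-cong (solve 2 (λ a b → b :- a := :- a :- :- b) ℚProps.≃-refl (term x m) (term x n)))
    (p n m N≤n N≤m)
    where open ℚSolver.+-*-Solver

  _-ℝ_ : ℝ → ℝ → ℝ
  x -ℝ y = x +ℝ (-ℝ y)

  _*ℝ_ : ℝ → ℝ → ℝ
  (x *ℝ y) .term n = term x n * term y n
  (x *ℝ y) .cauchy ε 0<ε with bounded x | bounded y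
  ... | B , M , 0<B , x<B | C , N , 0<C , y<C
    with abs-prod 0<B (ε * ½) (half>0 0<ε) | abs-prod 0<C (ε * ½) (half>0 0<ε)
  ... | δ , 0<δ , small | η , 0<η , small′
    with cauchy y δ 0<δ | cauchy x η 0<η
  ... | M′ , p | N′ , q = (M ℕ.⊔ N) ℕ.⊔ (M′ ℕ.⊔ N′) , λ m n ≤m ≤n → abs-halves ε
    (solve 4 (λ a b c d → a :* b :- c :* d := a :* (b :- d) :+ d :* (a :- c)) ℚProps.≃-refl
      (term x m) (term y m) (term x n) (term y n))
    (small _ _ (x<B m (left {M} (left ≤m)))
               (p m n (left {M′} (right {M ℕ.⊔ N} ≤m)) (left {M′} (right {M ℕ.⊔ N} ≤n))))
    (small′ _ _ (y<C n (right {M} (left ≤n)))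
                (q m n (right {M′} (right {M ℕ.⊔ N} ≤m)) (right {M′} (right {M ℕ.⊔ N} ≤n))))
    where open ℚSolver.+-*-Solver

  ∣_∣ℝ : ℝ → ℝ
  ∣ x ∣ℝ .term n = ∣ term x n ∣
  ∣ x ∣ℝ .cauchy ε 0<ε with cauchy x ε 0<ε
  ... | N , p = N , λ m n N≤m N≤n → abs-<
    (ℚProps.≤-<-trans (abs-diff (term x m) (term x n)) (p m n N≤m N≤n))
    (ℚProps.≤-<-trans
      (ℚProps.≤-trans
        (ℚProps.≤-reflexive (solve 2 (λ a b → :- (a :- b) := b :- a) ℚProps.≃-refl
          ∣ term x m ∣ ∣ term x n ∣))
        (abs-diff (term x n) (term x m)))
      (p n m N≤n N≤m))
    where open ℚSolver.+-*-Solver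

  ℝ-rawRing : RawRing 0ℓ 0ℓ
  ℝ-rawRing = record
    { Carrier = ℝ ; _≈_ = _≈ℝ_ ; _+_ = _+ℝ_ ; _*_ = _*ℝ_ ; -_ = -ℝ_
    ; 0# = fromℚ 0ℚᵘ ; 1# = fromℚ 1ℚᵘ }

  -- The facts about ℝ needed to see that a field embedded in it has
  -- characteristic zero.
  ≃⇒≈ℝ : ∀ {x y} → (∀ n → term x n ℚ.≃ term y n) → x ≈ℝ y
  ≃⇒≈ℝ {x} {y} e ε 0<ε = 0 , λ n _ → ℚProps.<-respˡ-≃
    (ℚProps.≃-sym (ℚProps.∣-∣-cong {q = 0ℚᵘ} (ℚProps.p≃q⇒p-q≃0 (term x n) (term y n) (e n)))) 0<ε

  ≈ℝ-sym : ∀ {x y} → x ≈ℝ y → y ≈ℝ x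
  ≈ℝ-sym {x} {y} p ε 0<ε with p ε 0<ε
  ... | N , h = N , λ n N≤n → ℚProps.<-respˡ-≃ (abs-swap (term x n) (term y n)) (h n N≤n)

  ≈ℝ-trans : ∀ {x y z} → x ≈ℝ y → y ≈ℝ z → x ≈ℝ z
  ≈ℝ-trans {x} {y} {z} p q ε 0<ε with p (ε * ½) (half>0 0<ε) | q (ε * ½) (half>0 0<ε)
  ... | M , h | N , k = M ℕ.⊔ N , λ n ≤n → abs-halves ε
    (ℚProps.≃-sym (ℚProps.+-minus-telescope (term x n) (term y n) (term z n)))
    (h n (left ≤n)) (k n (right ≤n))

  +ℝ-cong : ∀ {x y u v} → x ≈ℝ y → u ≈ℝ v → x +ℝ u ≈ℝ y +ℝ v
  +ℝ-cong {x} {y} {u} {v} p q ε 0<ε with p (ε * ½) (half>0 0<ε) | q (ε * ½) (half>0 0<ε)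
  ... | M , h | N , k = M ℕ.⊔ N , λ n ≤n → abs-halves ε
    (solve 4 (λ a b c d → (a :+ b) :- (c :+ d) := (a :- c) :+ (b :- d)) ℚProps.≃-refl
      (term x n) (term u n) (term y n) (term v n))
    (h n (left ≤n)) (k n (right ≤n))
    where open ℚSolver.+-*-Solver

  suc≉0 : ∀ d → ¬ (fromℚ (+ suc d / 1) ≈ℝ fromℚ 0ℚᵘ)
  suc≉0 d p with p 1ℚᵘ (ℚProps.positive⁻¹ 1ℚᵘ)
  ... | N , h with h N ℕProps.≤-refl
  ... | ℚ.*<* (ℤ.+<+ (ℕ.s≤s ()))

------------------------------------------------------------------------

module PAdic {p : ℕ} (p-prime : Prime p) where
  instance
    p≢0 : NonZero p
    p≢0 = prime⇒nonZero p-prime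

  p^≢0 : ∀ n → NonZero (p ℕ.^ n)
  p^≢0 n = ℕProps.m^n≢0 p n

  -- ℤₚ as the inverse limit of the ℤ/pⁿ: x is the compatible family of the
  -- classes of residue x n modulo pⁿ.
  record ℤₚ : Set where
    field
      residue  : ℕ → ℤ
      coherent : ∀ n → + (p ℕ.^ n) ∣ residue (suc n) ℤ.- residue n
  open ℤₚ public

  infix  4 _≈ℤₚ_ _≈ℚₚ_
  infixl 6 _+ℤₚ_ _+ℚₚ_ _-ℚₚ_
  infixl 7 _*ℤₚ_ _*ℚₚ_ _·p^_
  infix  8 -ℤₚ_ -ℚₚ_

  _≈ℤₚ_ : ℤₚ → ℤₚ → Set
  x ≈ℤₚ y = ∀ n → + (p ℕ.^ n) ∣ residue x n ℤ.- residue y n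

  private
    subst-∣ : ∀ {k i j} → i ≡ j → k ∣ i → k ∣ j
    subst-∣ {k} = subst (k ∣_)

  intℤₚ : ℤ → ℤₚ
  intℤₚ i .residue  _ = i
  intℤₚ i .coherent n = subst-∣ (sym (ℤProps.+-inverseʳ i)) (∣n⇒∣m*n (+ 0) ∣-refl)

  _+ℤₚ_ : ℤₚ → ℤₚ → ℤₚ
  (x +ℤₚ y) .residue  n = residue x n ℤ.+ residue y n
  (x +ℤₚ y) .coherent n = subst-∣
    (solve 4 (λ a b c d → (a :- c) :+ (b :- d) := (a :+ b) :- (c :+ d)) refl
      (residue x (suc n)) (residue y (suc n)) (residue x n) (residue y n))
    (∣m∣n⇒∣m+n (coherent x n) (coherent y n))
    where open ℤSolver.+-*-Solver

  -ℤₚ_ : ℤₚ → ℤₚ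
  (-ℤₚ x) .residue  n = ℤ.- residue x n
  (-ℤₚ x) .coherent n = subst-∣
    (solve 2 (λ a b → :- (a :- b) := :- a :- :- b) refl (residue x (suc n)) (residue x n))
    (∣m⇒∣-m (coherent x n))
    where open ℤSolver.+-*-Solver

  _*ℤₚ_ : ℤₚ → ℤₚ → ℤₚ
  (x *ℤₚ y) .residue  n = residue x n ℤ.* residue y n
  (x *ℤₚ y) .coherent n = subst-∣
    (solve 4 (λ a b c d → a :* (b :- d) :+ (a :- c) :* d := a :* b :- c :* d) refl
      (residue x (suc n)) (residue y (suc n)) (residue x n) (residue y n))
    (∣m∣n⇒∣m+n (∣n⇒∣m*n (residue x (suc n)) (coherent y n))
               (∣m⇒∣m*n (residue y n) (coherent x n)))
    where open ℤSolver.+-*-Solver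

  _·p^_ : ℤₚ → ℕ → ℤₚ
  x ·p^ k = x *ℤₚ intℤₚ (+ (p ℕ.^ k))

  -- The coefficient of p^j in the expansion of x with digits in {0,…,p-1}.
  digit : ℤₚ → ℕ → ℕ
  digit x j = (residue x (suc j) ℤ.%ℕ (p ℕ.^ suc j)) ℕ./ (p ℕ.^ j)
    where instance _ = p^≢0 j
                   _ = p^≢0 (suc j)

  -- ℚₚ = ℤₚ[1/p]: x /p^ k stands for x / pᵏ.
  infix 5 _/p^_
  record ℚₚ : Set where
    constructor _/p^_
    field
      mantissa : ℤₚ
      exponent : ℕ

  _≈ℚₚ_ : ℚₚ → ℚₚ → Set
  (x /p^ k) ≈ℚₚ (y /p^ l) = x ·p^ l ≈ℤₚ y ·p^ k

  _+ℚₚ_ : ℚₚ → ℚₚ → ℚₚ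
  (x /p^ k) +ℚₚ (y /p^ l) = (x ·p^ l +ℤₚ y ·p^ k) /p^ (k ℕ.+ l)

  _*ℚₚ_ : ℚₚ → ℚₚ → ℚₚ
  (x /p^ k) *ℚₚ (y /p^ l) = (x *ℤₚ y) /p^ (k ℕ.+ l)

  -ℚₚ_ : ℚₚ → ℚₚ
  -ℚₚ (x /p^ k) = (-ℤₚ x) /p^ k

  _-ℚₚ_ : ℚₚ → ℚₚ → ℚₚ
  u -ℚₚ v = u +ℚₚ (-ℚₚ v)

  ℚₚ-rawRing : RawRing 0ℓ 0ℓ
  ℚₚ-rawRing = record
    { Carrier = ℚₚ ; _≈_ = _≈ℚₚ_ ; _+_ = _+ℚₚ_ ; _*_ = _*ℚₚ_ ; -_ = -ℚₚ_
    ; 0# = intℤₚ (+ 0) /p^ 0 ; 1# = intℤₚ (+ 1) /p^ 0 }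

  -- vₚ(u) ≥ m, that is, u ∈ pᵐℤₚ; every m holds for u = 0.
  v[_]≥_ : ℚₚ → ℕ → Set
  v[ u ]≥ m = ∃ λ (y : ℤₚ) → u ≈ℚₚ (y ·p^ m /p^ 0)

  digitSum : ℤₚ → ℕ → ℕ
  digitSum x zero    = 0
  digitSum x (suc j) = digitSum x j ℕ.+ digit x j ℕ.* p ℕ.^ j

  -- The digit of x/pᵏ at pⁿ is digit x (n + k), so the terms with n ≤ 0 are
  -- those with index at most k in the expansion of x.
  ⌊_⌋ₚ : ℚₚ → ℚᵘ
  ⌊ x /p^ k ⌋ₚ = + digitSum x (suc k) / (p ℕ.^ k)
    where instance _ = p^≢0 k

  TendsTo : (ℕ → ℚₚ) → ℚₚ → Set
  TendsTo u l = ∀ m → ∃ λ N → ∀ n → N ℕ.≤ n → v[ u n -ℚₚ l ]≥ m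

------------------------------------------------------------------------

IsSmallestMinimizer : (ℤ → ℝ) → ℤ → Set
IsSmallestMinimizer f m = Minimizes m × (∀ i → Minimizes i → m ℤ.≤ i)
  where
  Minimizes : ℤ → Set
  Minimizes i = ∀ j → f i ≤ℝ f j

-- The number of the last partial quotient, or ∞ if there is no last one.
data Length : Set where
  finite   : ℕ → Length
  infinite : Length

_within_ : ℕ → Length → Set
n within finite N = n ℕ.≤ N
n within infinite = ⊤

module Algorithm
  {c ℓ : Level} {p : ℕ} (p-prime : Prime p) (K : Field c ℓ)
  (σ∞ : Field.Carrier K → ℝ) (σₚ : Field.Carrier K → PAdic.ℚₚ p-prime)
  (σ∞-mono : RingMorphisms.IsRingMonomorphism (Field.rawRing K) ℝ-rawRing σ∞)
  where

  open PAdic p-prime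
  open Field K using (Carrier; _≈_; _+_; _*_; _-_; 0#; 1#; inv; fromℤ; +-rawMonoid)
  open RawMonoidDefs +-rawMonoid using () renaming (_×_ to _×ⁿ_)
  private
    module σ∞ = RingMorphisms.IsRingMonomorphism σ∞-mono

  σ∞-× : ∀ n → σ∞ (n ×ⁿ 1#) ≈ℝ fromℚ (+ n / 1)
  σ∞-× zero    = σ∞.0#-homo
  σ∞-× (suc n) =
    ≈ℝ-trans {σ∞ (suc n ×ⁿ 1#)} {σ∞ 1# +ℝ σ∞ (n ×ⁿ 1#)} {fromℚ (+ suc n / 1)}
      (σ∞.+-homo 1# (n ×ⁿ 1#))
      (≈ℝ-trans {σ∞ 1# +ℝ σ∞ (n ×ⁿ 1#)} {fromℚ 1ℚᵘ +ℝ fromℚ (+ n / 1)} {fromℚ (+ suc n / 1)}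
        (+ℝ-cong {σ∞ 1#} {fromℚ 1ℚᵘ} {σ∞ (n ×ⁿ 1#)} {fromℚ (+ n / 1)} σ∞.1#-homo (σ∞-× n))
        (≃⇒≈ℝ {fromℚ 1ℚᵘ +ℝ fromℚ (+ n / 1)} {fromℚ (+ suc n / 1)}
          (λ _ → ℚ.*≡* (solve 1 (λ a → (con (+ 1) :* con (+ 1) :+ a :* con (+ 1)) :* con (+ 1)
                                  := (con (+ 1) :+ a) :* con (+ 1)) refl (+ n)))))
    where open ℤSolver.+-*-Solver

  characteristic-zero : ∀ d → ¬ (fromℤ (+ suc d) ≈ 0#)
  characteristic-zero d d≈0 = suc≉0 d
    (≈ℝ-trans {fromℚ (+ suc d / 1)} {σ∞ (suc d ×ⁿ 1#)} {fromℚ 0ℚᵘ}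
      (≈ℝ-sym {σ∞ (suc d ×ⁿ 1#)} {fromℚ (+ suc d / 1)} (σ∞-× (suc d)))
      (≈ℝ-trans {σ∞ (suc d ×ⁿ 1#)} {σ∞ 0#} {fromℚ 0ℚᵘ} (σ∞.⟦⟧-cong d≈0) σ∞.0#-homo))

  ι : ℚᵘ → Carrier
  ι (mkℚᵘ n d) = fromℤ n * inv (fromℤ (+ suc d)) (characteristic-zero d)

  PropertyI : Carrier → Set
  PropertyI α = (fromℚ (ℤ.- + p / 2) <ℝ σ∞ α × σ∞ α ≤ℝ fromℚ (+ p / 2))
              × v[ σₚ α ]≥ 1

  spacing : Parity → ℕ
  spacing 0ℙ = p
  spacing 1ℙ = 1

  -- a = a^(ε)(α).
  IsPartialQuotient : Parity → (α : Carrier) → ¬ (α ≈ 0#) → Carrier → Set ℓ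
  IsPartialQuotient ε α α≉0 a =
    ∃ λ m → IsSmallestMinimizer (λ i → ∣ σ∞ 1/α -ℝ fromℚ (multiple i) -ℝ fromℚ ⌊ σₚ 1/α ⌋ₚ ∣ℝ) m
          × a ≈ ι (multiple m ℚ.+ ⌊ σₚ 1/α ⌋ₚ)
    where
    1/α : Carrier
    1/α = inv α α≉0
    multiple : ℤ → ℚᵘ
    multiple i = i ℤ.* + spacing ε / 1

  -- A complete execution of the algorithm on α.  The smallest minimizer is
  -- described rather than computed, as minimization over ℝ is not decidable;
  -- the description determines every α_(n) and a_n up to ≈.  Entry 0 of the two
  -- sequences, and entries past the point of termination, are meaningless.
  record Run (α : Carrier) (L : Length) : Set (c ⊔ ℓ) where
    field
      state    : ℕ → Carrier
      quotient : ℕ → Carrier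
      start    : state 1 ≈ α
      nonzero  : ∀ n → 1 ℕ.≤ n → n within L → ¬ (state n ≈ 0#)
      select   : ∀ n (1≤n : 1 ℕ.≤ n) (n≤L : n within L) →
                 IsPartialQuotient (parity n) (state n) (nonzero n 1≤n n≤L) (quotient n)
      next     : ∀ n (1≤n : 1 ℕ.≤ n) (n≤L : n within L) →
                 state (suc n) ≈ inv (state n) (nonzero n 1≤n n≤L) - quotient n
      stop     : ∀ N → L ≡ finite N → state (suc N) ≈ 0#

  record Matrix₂ : Set c where
    constructor mat
    field
      e₁₁ e₁₂ e₂₁ e₂₂ : Carrier
  open Matrix₂ public

  infixl 7 _⊗_
  _⊗_ : Matrix₂ → Matrix₂ → Matrix₂
  mat a b c d ⊗ mat a′ b′ c′ d′ =
    mat (a * a′ + b * c′) (a * b′ + b * d′) (c * a′ + d * c′) (c * b′ + d * d′)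

  -- The empty product is the identity, whose second column is p₀ = 0, q₀ = 1.
  convergentMatrix : (ℕ → Carrier) → ℕ → Matrix₂
  convergentMatrix a zero    = mat 1# 0# 0# 1#
  convergentMatrix a (suc n) = convergentMatrix a n ⊗ mat 0# 1# 1# (a (suc n))

  pₙ qₙ : (ℕ → Carrier) → ℕ → Carrier
  pₙ a n = e₁₂ (convergentMatrix a n)
  qₙ a n = e₂₂ (convergentMatrix a n)

  -- For a finite sequence the limit is the last term.
  HasLimit : (L : Length) → (∀ n → n within L → ℚₚ) → ℚₚ → Set
  HasLimit (finite N) u l = u N ℕProps.≤-refl ≈ℚₚ l
  HasLimit infinite   u l = TendsTo (λ n → u n tt) l

  -- The nonvanishing of the denominators is part of the assertion, as it gives
  -- the fractions pₙ/qₙ their meaning.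
  ConvergentsTendTo : ∀ {α L} → Run α L → ℚₚ → Set ℓ
  ConvergentsTendTo {L = L} r l =
    Σ[ q≉0 ∈ (∀ n → n within L → ¬ (qₙ a n ≈ 0#)) ]
      HasLimit L (λ n n≤L → σₚ (pₙ a n * inv (qₙ a n) (q≉0 n n≤L))) l
    where
    a : ℕ → Carrier
    a = Run.quotient r

{-# OPTIONS --safe #-}

-- Write xₙ for α₍ₙ₎.  Since 1/xₙ - ⌊1/xₙ⌋ₚ ∈ pℤₚ, and aₙ - ⌊1/xₙ⌋ₚ is an integer,
-- divisible by p for even n, vₚ(xₙ) ≥ 1 for odd n and vₚ(xₙ) ≥ 0 for even n; which
-- integer is chosen does not matter.  In particular xₙxₙ₊₁ ∈ pℤₚ.  With Uₙ = qₙx₁⋯xₙ, the recurrence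
-- of the convergents and aₙ = 1/xₙ - xₙ₊₁ give
--   Uₙ = (1 - xₙxₙ₊₁) Uₙ₋₁ + xₙ₋₁xₙ Uₙ₋₂,
-- so Uₙ ≡ 1 modulo p, whence qₙ ≠ 0.  On the other hand
--   qₙα - pₙ = -xₙ₊₁ (qₙ₋₁α - pₙ₋₁),
-- which is integral, and vanishes if xₙ₊₁ = 0.  Therefore
--   (pₙ/qₙ - α) Uₙ = -(qₙα - pₙ) x₁⋯xₙ
-- has valuation at least ⌊n/2⌋, and so does pₙ/qₙ - α.

module Submission where

open import Level using (0ℓ)
open import Data.Nat.Base as ℕ using (ℕ; zero; suc; _^_; NonZero; parity)
import Data.Nat.Divisibility as ℕDiv
import Data.Nat.DivMod as ℕDivMod
open import Data.Nat.Primality using (Prime; ¬prime[1])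
import Data.Nat.Properties as ℕProps
import Data.Nat.Solver as ℕSolver
open import Data.Integer.Base as ℤ using (ℤ; +_; -[1+_]; _%ℕ_)
open import Data.Integer.Divisibility.Signed
import Data.Integer.DivMod as ℤDivMod
import Data.Integer.Properties as ℤProps
import Data.Integer.Solver as ℤSolver
open import Data.Maybe.Base as Maybe using (Maybe)
open import Data.Parity.Base using (Parity; 0ℙ; 1ℙ)
open import Data.Product.Base using (∃; _,_; proj₁; proj₂)
open import Data.Rational.Unnormalised as ℚ using (ℚᵘ; mkℚᵘ; _/_)
open import Data.Sum.Base using (inj₁; inj₂)
open import Data.Unit.Base using (tt)
import Algebra.Definitions.RawMonoid as RawMonoidDefs
open import Algebra.Morphism.Structures using (module RingMorphisms)
import Algebra.Properties.Ring as RingProperties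
import Algebra.Solver.Ring as RingSolver
open import Algebra.Solver.Ring.AlmostCommutativeRing
  using (AlmostCommutativeRing; fromCommutativeRing; _-Raw-AlmostCommutative⟶_)
open import Relation.Binary.Bundles using (Setoid)
open import Relation.Binary.PropositionalEquality
  using (_≡_; refl; sym; trans; cong; cong₂; subst; subst₂)
import Relation.Binary.Reasoning.Setoid as SetoidReasoning
open import Relation.Nullary.Decidable.Core using (dec⇒maybe)
open import Relation.Nullary.Negation using (¬_; contradiction)
open import Defs

-- Divisibility and remainders in ℤ.

module _ where
  open import Data.Integer.Base using (_+_; _*_; _-_; -_)

  ∣m∣m-n⇒∣n : ∀ {k} m n → k ∣ m → k ∣ m - n → k ∣ n
  ∣m∣m-n⇒∣n m n k∣m k∣m-n = subst (_ ∣_)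
    (solve 2 (λ m n → m :- (m :- n) := n) refl m n) (∣m∣n⇒∣m-n k∣m k∣m-n)
    where open ℤSolver.+-*-Solver

  ∣m-n∣n⇒∣m : ∀ {k} m n → k ∣ m - n → k ∣ n → k ∣ m
  ∣m-n∣n⇒∣m m n k∣m-n k∣n = subst (_ ∣_)
    (solve 2 (λ m n → m :- n :+ n := m) refl m n) (∣m∣n⇒∣m+n k∣m-n k∣n)
    where open ℤSolver.+-*-Solver

  *-mono-∣ : ∀ {i j k l} → i ∣ j → k ∣ l → i * k ∣ j * l
  *-mono-∣ {j = j} {k} i∣j k∣l = ∣-trans (*-monoˡ-∣ k i∣j) (*-monoʳ-∣ j k∣l)

  -- Remainders modulo d are unique: if n ≤ m, then `m ∸ n` is below d and divisible by d, hence 0.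
  -- `below` yields one inequality, and negating the difference yields the other.
  ∣m-n⇒≡ : ∀ {d m n} → m ℕ.< d → n ℕ.< d → + d ∣ + m - + n → m ≡ n
  ∣m-n⇒≡ {d} {m} {n} m<d n<d d∣m-n = ℕProps.≤-antisym (below m<d d∣m-n)
    (below n<d (subst (+ d ∣_) (negate m n) (∣m⇒∣-m d∣m-n)))
    where
    open ℤSolver.+-*-Solver
    negate : ∀ m n → - (+ m - + n) ≡ + n - + m
    negate m n = solve 2 (λ m n → :- (m :- n) := n :- m) refl (+ m) (+ n)
    small : ∀ {k} → k ℕ.< d → d ℕDiv.∣ k → k ≡ 0
    small {zero}  _   _   = refl
    small {suc _} k<d d∣k = contradiction d∣k (ℕDiv.>⇒∤ k<d)
    below : ∀ {m n} → m ℕ.< d → + d ∣ + m - + n → m ℕ.≤ n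
    below {m} {n} m<d d∣m-n with ℕProps.≤-total m n
    ... | inj₁ m≤n = m≤n
    ... | inj₂ n≤m = ℕProps.m∸n≡0⇒m≤n (small (ℕProps.≤-<-trans (ℕProps.m∸n≤m m n) m<d)
      (subst (d ℕDiv.∣_) (cong ℤ.∣_∣ (trans (ℤProps.m-n≡m⊖n m n) (ℤProps.⊖-≥ n≤m))) (∣⇒∣ᵤ d∣m-n)))

  ∣a-a%ℕd : ∀ a d .{{_ : NonZero d}} → + d ∣ a - + (a %ℕ d)
  ∣a-a%ℕd a d = divides (a ℤ./ℕ d) (trans (cong (_- + (a %ℕ d)) (ℤDivMod.a≡a%ℕn+[a/ℕn]*n a d))
    (solve 2 (λ r q → r :+ q :- r := q) refl (+ (a %ℕ d)) ((a ℤ./ℕ d) * + d)))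
    where open ℤSolver.+-*-Solver

-- The filtration of ℚₚ by the powers pᵐℤₚ.

module Valuation {p : ℕ} (p-prime : Prime p) where
  open PAdic p-prime
  open import Data.Integer.Base using (_+_; _*_; _-_; -_)

  π : ℕ → ℤ
  π n = + (p ^ n)

  π-+ : ∀ m n → π (m ℕ.+ n) ≡ π m * π n
  π-+ m n = trans (cong +_ (ℕProps.^-distribˡ-+-* p m n)) (ℤProps.pos-* (p ^ m) (p ^ n))

  π-mono : ∀ {m n} → m ℕ.≤ n → π m ∣ π n
  π-mono {m} m≤n = ∣ᵤ⇒∣ (subst (p ^ m ℕDiv.∣_)
    (trans (sym (ℕProps.^-distribˡ-+-* p m _)) (cong (p ^_) (ℕProps.m+[n∸m]≡n m≤n)))
    (ℕDiv.m∣m*n _))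

  -- The index `i` is tied to `n + k` only by an equation, because the levels that occur are sums
  -- associated or ordered in other ways.
  raise : ∀ {i} n {k z} → i ≡ n ℕ.+ k → π n ∣ z → π i ∣ z * π k
  raise n {k} refl n∣z = subst (_∣ _) (sym (π-+ n k)) (*-monoˡ-∣ (π k) n∣z)

  lower : ∀ {i} n {k z} → i ≡ n ℕ.+ k → π i ∣ z * π k → π n ∣ z
  lower n {k} {z} refl i∣z = *-cancelʳ-∣ (π k) {π n} {z} (subst (_∣ _) (π-+ n k) i∣z)
    where instance _ = p^≢0 k

  residue-coherent : ∀ x {m n} → m ℕ.≤ n → π m ∣ residue x n - residue x m
  residue-coherent x {m} {n} m≤n = go (ℕProps.≤⇒≤′ m≤n)
    where
    open ℤSolver.+-*-Solver
    go : ∀ {n} → m ℕ.≤′ n → π m ∣ residue x n - residue x m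
    go (ℕ.≤′-reflexive refl) = subst (_ ∣_) (sym (ℤProps.+-inverseʳ (residue x m))) (divides (+ 0) refl)
    go {suc n} (ℕ.≤′-step m≤n) = subst (_ ∣_)
      (solve 3 (λ a b c → (a :- b) :+ (b :- c) := a :- c) refl (residue x (suc n)) (residue x n) (residue x m))
      (∣m∣n⇒∣m+n (∣-trans (π-mono (ℕProps.≤′⇒≤ m≤n)) (coherent x n)) (go m≤n))

  ∣residue-↑ : ∀ x {m n} → m ℕ.≤ n → π m ∣ residue x m → π m ∣ residue x n
  ∣residue-↑ x m≤n = ∣m-n∣n⇒∣m (residue x _) (residue x _) (residue-coherent x m≤n)

  ∣residue-↓ : ∀ x {m n} → m ℕ.≤ n → π m ∣ residue x n → π m ∣ residue x m
  ∣residue-↓ x m≤n m∣x = ∣m∣m-n⇒∣n (residue x _) (residue x _) m∣x (residue-coherent x m≤n)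

  -- vₚ(x/pᵏ) ≥ m is decided by x modulo pᵐ⁺ᵏ.
  infix 4 _∈p^_
  _∈p^_ : ℚₚ → ℕ → Set
  (x /p^ k) ∈p^ m = π (m ℕ.+ k) ∣ residue x (m ℕ.+ k)

  -- At level m + k + l both denominators can be cleared: pˡ times the residue of x is divisible by
  -- p^(m+k+l), hence so is pᵏ times the residue of y, and cancelling pᵏ leaves divisibility by
  -- p^(m+l).
  ∈p^-resp-≈ : ∀ u v {m} → u ≈ℚₚ v → u ∈p^ m → v ∈p^ m
  ∈p^-resp-≈ (x /p^ k) (y /p^ l) {m} u≈v u∈ = ∣residue-↓ y m+l≤N (lower (m ℕ.+ l) N≡
    (∣m∣m-n⇒∣n (residue x N * π l) (residue y N * π k)
      (raise (m ℕ.+ k) refl (∣residue-↑ x (ℕProps.m≤m+n (m ℕ.+ k) l) u∈)) (u≈v N)))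
    where
    N : ℕ
    N = m ℕ.+ k ℕ.+ l
    N≡ : N ≡ m ℕ.+ l ℕ.+ k
    N≡ = ℕSolver.+-*-Solver.solve 3 (λ m k l → m :+ k :+ l := m :+ l :+ k) refl m k l
      where open ℕSolver.+-*-Solver
    m+l≤N : m ℕ.+ l ℕ.≤ N
    m+l≤N = ℕProps.≤-trans (ℕProps.m≤m+n (m ℕ.+ l) k) (ℕProps.≤-reflexive (sym N≡))

  ∈p^-weaken : ∀ {u m n} → m ℕ.≤ n → u ∈p^ n → u ∈p^ m
  ∈p^-weaken {x /p^ k} m≤n u∈ = ∣residue-↓ x (ℕProps.+-monoˡ-≤ k m≤n)
    (∣-trans (π-mono (ℕProps.+-monoˡ-≤ k m≤n)) u∈)

  ∈p^-+ : ∀ {u v m} → u ∈p^ m → v ∈p^ m → u +ℚₚ v ∈p^ m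
  ∈p^-+ {x /p^ k} {y /p^ l} {m} u∈ v∈ = ∣m∣n⇒∣m+n
    (raise (m ℕ.+ k) Nk (∣residue-↑ x (ℕProps.+-monoʳ-≤ m (ℕProps.m≤m+n k l)) u∈))
    (raise (m ℕ.+ l) Nl (∣residue-↑ y (ℕProps.+-monoʳ-≤ m (ℕProps.m≤n+m l k)) v∈))
    where
    open ℕSolver.+-*-Solver
    Nk : m ℕ.+ (k ℕ.+ l) ≡ m ℕ.+ k ℕ.+ l
    Nk = sym (ℕProps.+-assoc m k l)
    Nl : m ℕ.+ (k ℕ.+ l) ≡ m ℕ.+ l ℕ.+ k
    Nl = solve 3 (λ m k l → m :+ (k :+ l) := m :+ l :+ k) refl m k l

  ∈p^-neg : ∀ {u m} → u ∈p^ m → -ℚₚ u ∈p^ m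
  ∈p^-neg = ∣m⇒∣-m

  ∈p^-* : ∀ {u v m n} → u ∈p^ m → v ∈p^ n → u *ℚₚ v ∈p^ (m ℕ.+ n)
  ∈p^-* {x /p^ k} {y /p^ l} {m} {n} u∈ v∈ = subst (_∣ _)
    (trans (sym (π-+ (m ℕ.+ k) (n ℕ.+ l))) (cong π (sym N≡)))
    (*-mono-∣ (∣residue-↑ x k≤ u∈) (∣residue-↑ y l≤ v∈))
    where
    open ℕSolver.+-*-Solver
    N≡ : m ℕ.+ n ℕ.+ (k ℕ.+ l) ≡ m ℕ.+ k ℕ.+ (n ℕ.+ l)
    N≡ = solve 4 (λ m n k l → m :+ n :+ (k :+ l) := m :+ k :+ (n :+ l)) refl m n k l
    k≤ : m ℕ.+ k ℕ.≤ m ℕ.+ n ℕ.+ (k ℕ.+ l)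
    k≤ = ℕProps.≤-trans (ℕProps.m≤m+n (m ℕ.+ k) (n ℕ.+ l)) (ℕProps.≤-reflexive (sym N≡))
    l≤ : n ℕ.+ l ℕ.≤ m ℕ.+ n ℕ.+ (k ℕ.+ l)
    l≤ = ℕProps.≤-trans (ℕProps.m≤n+m (n ℕ.+ l) (m ℕ.+ k)) (ℕProps.≤-reflexive (sym N≡))

  -- Multiplication by u loses at most as many powers of p as its denominator has.
  ∈p^-*-bounded : ∀ {u v m} → v ∈p^ (m ℕ.+ ℚₚ.exponent u) → u *ℚₚ v ∈p^ m
  ∈p^-*-bounded {x /p^ k} {y /p^ l} {m} v∈ = ∣n⇒∣m*n (residue x (m ℕ.+ (k ℕ.+ l)))
    (subst (λ i → π i ∣ residue y i) (ℕProps.+-assoc m k l) v∈)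

  integer∈p^ : ∀ {z m} → π m ∣ z → intℤₚ z /p^ 0 ∈p^ m
  integer∈p^ {z} {m} = subst (λ i → π i ∣ z) (sym (ℕProps.+-identityʳ m))

  1∉p^1 : ¬ (intℤₚ (+ 1) /p^ 0 ∈p^ 1)
  1∉p^1 1∈ = ¬prime[1] (subst Prime
    (trans (sym (ℕProps.^-identityʳ p)) (ℕDiv.∣1⇒≡1 (∣⇒∣ᵤ 1∈))) p-prime)

  -- Equality in ℚₚ as a congruence, and its agreement with the valuation.

  ≈ℚₚ-refl : ∀ u → u ≈ℚₚ u
  ≈ℚₚ-refl (x /p^ k) n = divides (+ 0) (ℤProps.+-inverseʳ (residue x n * π k))

  ≈ℚₚ-sym : ∀ u v → u ≈ℚₚ v → v ≈ℚₚ u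
  ≈ℚₚ-sym (x /p^ k) (y /p^ l) u≈v n = subst (_ ∣_)
    (solve 2 (λ a b → :- (a :- b) := b :- a) refl (residue x n * π l) (residue y n * π k))
    (∣m⇒∣-m (u≈v n))
    where open ℤSolver.+-*-Solver

  -- Cross-multiplying the two hypotheses gives the conclusion only up to the factor pˡ of the
  -- middle term. It is therefore carried out at level n + l, where cancelling pˡ still leaves a
  -- congruence modulo pⁿ.
  ≈ℚₚ-trans : ∀ u v w → u ≈ℚₚ v → v ≈ℚₚ w → u ≈ℚₚ w
  ≈ℚₚ-trans (x /p^ k) (y /p^ l) (z /p^ m) u≈v v≈w n =
    ∣residue-↓ (x ·p^ m +ℤₚ -ℤₚ (z ·p^ k)) (ℕProps.m≤m+n n l)
    (lower n refl (subst (π N ∣_)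
      (solve 6 (λ x y z k l m → (x :* l :- y :* k) :* m :+ (y :* m :- z :* l) :* k
                             := (x :* m :+ :- (z :* k)) :* l) refl
        (residue x N) (residue y N) (residue z N) (π k) (π l) (π m))
      (∣m∣n⇒∣m+n (∣m⇒∣m*n (π m) (u≈v N)) (∣m⇒∣m*n (π k) (v≈w N)))))
    where
    open ℤSolver.+-*-Solver
    N : ℕ
    N = n ℕ.+ l

  +ℚₚ-cong : ∀ u u′ v v′ → u ≈ℚₚ u′ → v ≈ℚₚ v′ → u +ℚₚ v ≈ℚₚ u′ +ℚₚ v′
  +ℚₚ-cong (x /p^ k) (x′ /p^ k′) (y /p^ l) (y′ /p^ l′) u≈ v≈ n
    = subst₂ (λ s t → π n ∣ (residue x n * π l + residue y n * π k) * s
                            - (residue x′ n * π l′ + residue y′ n * π k′) * t)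
      (sym (π-+ k′ l′)) (sym (π-+ k l)) (subst (_ ∣_)
      (solve 8 (λ x x′ y y′ k k′ l l′ →
          (x :* k′ :- x′ :* k) :* (l :* l′) :+ (y :* l′ :- y′ :* l) :* (k :* k′)
          := (x :* l :+ y :* k) :* (k′ :* l′) :- (x′ :* l′ :+ y′ :* k′) :* (k :* l)) refl
        (residue x n) (residue x′ n) (residue y n) (residue y′ n) (π k) (π k′) (π l) (π l′))
      (∣m∣n⇒∣m+n (∣m⇒∣m*n (π l * π l′) (u≈ n)) (∣m⇒∣m*n (π k * π k′) (v≈ n))))
    where open ℤSolver.+-*-Solver

  *ℚₚ-cong : ∀ u u′ v v′ → u ≈ℚₚ u′ → v ≈ℚₚ v′ → u *ℚₚ v ≈ℚₚ u′ *ℚₚ v′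
  *ℚₚ-cong (x /p^ k) (x′ /p^ k′) (y /p^ l) (y′ /p^ l′) u≈ v≈ n
    = subst₂ (λ s t → π n ∣ residue x n * residue y n * s - residue x′ n * residue y′ n * t)
      (sym (π-+ k′ l′)) (sym (π-+ k l)) (subst (_ ∣_)
      (solve 8 (λ x x′ y y′ k k′ l l′ →
          (x :* k′ :- x′ :* k) :* (y :* l′) :+ (y :* l′ :- y′ :* l) :* (x′ :* k)
          := (x :* y) :* (k′ :* l′) :- (x′ :* y′) :* (k :* l)) refl
        (residue x n) (residue x′ n) (residue y n) (residue y′ n) (π k) (π k′) (π l) (π l′))
      (∣m∣n⇒∣m+n (∣m⇒∣m*n (residue y n * π l′) (u≈ n)) (∣m⇒∣m*n (residue x′ n * π k) (v≈ n))))
    where open ℤSolver.+-*-Solver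

  -ℚₚ-cong : ∀ u v → u ≈ℚₚ v → -ℚₚ u ≈ℚₚ -ℚₚ v
  -ℚₚ-cong (x /p^ k) (y /p^ l) u≈v n = subst (_ ∣_)
    (solve 4 (λ x y k l → :- (x :* l :- y :* k) := :- x :* l :- :- y :* k) refl
      (residue x n) (residue y n) (π k) (π l))
    (∣m⇒∣-m (u≈v n))
    where open ℤSolver.+-*-Solver

  v≥⇒∈p^ : ∀ {u m} → v[ u ]≥ m → u ∈p^ m
  v≥⇒∈p^ {u} {m} (y , u≈y) = ∈p^-resp-≈ (y ·p^ m /p^ 0) u (≈ℚₚ-sym u (y ·p^ m /p^ 0) u≈y)
    (∣n⇒∣m*n (residue y (m ℕ.+ 0)) (subst (λ i → π i ∣ π m) (sym (ℕProps.+-identityʳ m)) ∣-refl))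

  -- With j = m + k, the witness y is x divided by pʲ. Dividing loses j levels of precision, so the
  -- residue of y at n comes from the residue of x at n + j.
  ∈p^⇒v≥ : ∀ {u m} → u ∈p^ m → v[ u ]≥ m
  ∈p^⇒v≥ {x /p^ k} {m} u∈ = y , u≈y
    where
    open ℤSolver.+-*-Solver
    j : ℕ
    j = m ℕ.+ k
    j∣x : ∀ n → π j ∣ residue x (n ℕ.+ j)
    j∣x n = ∣residue-↑ x (ℕProps.m≤n+m j n) u∈
    x/pʲ : ℕ → ℤ
    x/pʲ n = _∣_.quotient (j∣x n)
    y : ℤₚ
    y .residue n = x/pʲ n
    y .coherent n = lower n refl (subst (π (n ℕ.+ j) ∣_)
      (trans (cong₂ _-_ (_∣_.equality (j∣x (suc n))) (_∣_.equality (j∣x n)))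
        (solve 3 (λ a b c → a :* c :- b :* c := (a :- b) :* c) refl (x/pʲ (suc n)) (x/pʲ n) (π j)))
      (coherent x (n ℕ.+ j)))
    u≈y : (x /p^ k) ≈ℚₚ (y ·p^ m /p^ 0)
    -- The residue of y times pᵐpᵏ is `residue x (n + j)` itself, so only the coherence of x between
    -- the levels n and n + j is left.
    u≈y n = subst (π n ∣_)
      (trans (solve 2 (λ a b → :- (b :- a) := a :* con (+ 1) :- b) refl (residue x n) (residue x (n ℕ.+ j)))
        (cong (_-_ (residue x n * + 1)) (trans (_∣_.equality (j∣x n))
          (trans (cong (x/pʲ n *_) (π-+ m k)) (sym (ℤProps.*-assoc (x/pʲ n) (π m) (π k)))))))
      (∣m⇒∣-m (residue-coherent x (ℕProps.m≤m+n n j)))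

  -- Digit sums, and approximation by integers after clearing denominators.

  residue%ℕ : ℤₚ → ℕ → ℕ
  residue%ℕ x n = residue x n %ℕ p ^ n
    where instance _ = p^≢0 n

  -- Divide the remainder of x modulo pⁿ⁺¹ by pⁿ: the quotient is the digit at n by definition, and
  -- the rest is the remainder of x modulo pⁿ by coherence and uniqueness of remainders.
  digitSum≡ : ∀ x n → digitSum x n ≡ residue%ℕ x n
  digitSum≡ x zero    = sym (ℕProps.n<1⇒n≡0 (ℤDivMod.n%ℕd<d (residue x 0) 1))
  digitSum≡ x (suc n) = trans (cong (ℕ._+ digit x n ℕ.* p ^ n) (trans (digitSum≡ x n) r≡))
    (sym (ℕDivMod.m≡m%n+[m/n]*n (residue%ℕ x (suc n)) (p ^ n)))
    where
    open ℤSolver.+-*-Solver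
    instance _ = p^≢0 n
             _ = p^≢0 (suc n)
    s : ℕ
    s = residue%ℕ x (suc n)
    π∣π : π n ∣ π (suc n)
    π∣π = π-mono (ℕProps.n≤1+n n)
    r≡ : residue%ℕ x n ≡ s ℕ.% p ^ n
    r≡ = ∣m-n⇒≡ (ℤDivMod.n%ℕd<d (residue x n) (p ^ n)) (ℕDivMod.m%n<n s (p ^ n))
      (subst (π n ∣_)
        (solve 5 (λ a b r s t → (b :- s) :+ (s :- t) :- (a :- r) :- (b :- a) := r :- t) refl
          (residue x n) (residue x (suc n)) (+ residue%ℕ x n) (+ s) (+ (s ℕ.% p ^ n)))
        (∣m∣n⇒∣m-n (∣m∣n⇒∣m-n
          (∣m∣n⇒∣m+n (∣-trans π∣π (∣a-a%ℕd (residue x (suc n)) (p ^ suc n))) (∣a-a%ℕd (+ s) (p ^ n)))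
          (∣a-a%ℕd (residue x n) (p ^ n)))
          (coherent x n)))

  ∣residue-digitSum : ∀ x n → π n ∣ residue x n - + digitSum x n
  ∣residue-digitSum x n = subst (λ s → π n ∣ residue x n - + s) (sym (digitSum≡ x n))
    (∣a-a%ℕd (residue x n) (p ^ n))
    where instance _ = p^≢0 n

  u*pᵏ∈p^⇒u∈p^ : ∀ u {k m} → u *ℚₚ (intℤₚ (π k) /p^ 0) ∈p^ (m ℕ.+ k) → u ∈p^ m
  u*pᵏ∈p^⇒u∈p^ (y /p^ l) {k} {m} upᵏ∈ = ∣residue-↓ y m+l≤N (lower (m ℕ.+ l) N≡ upᵏ∈)
    where
    N : ℕ
    N = m ℕ.+ k ℕ.+ (l ℕ.+ 0)
    N≡ : N ≡ m ℕ.+ l ℕ.+ k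
    N≡ = solve 3 (λ m k l → m :+ k :+ (l :+ con 0) := m :+ l :+ k) refl m k l
      where open ℕSolver.+-*-Solver
    m+l≤N : m ℕ.+ l ℕ.≤ N
    m+l≤N = ℕProps.≤-trans (ℕProps.m≤m+n (m ℕ.+ l) k) (ℕProps.≤-reflexive (sym N≡))

  -- The product of x/pᵏ with pᵏ keeps the exponent k and has mantissa pᵏx. The whole difference is
  -- thus pᵏ(x - z) over pᵏ, and `raise` accounts for the extra factor.
  pᵏ*-approximation : ∀ x k {z m} → π (m ℕ.+ k) ∣ residue x (m ℕ.+ k) - z →
                      (x /p^ k) *ℚₚ (intℤₚ (π k) /p^ 0) -ℚₚ (intℤₚ z /p^ 0) ∈p^ (m ℕ.+ k)
  pᵏ*-approximation x k {z} {m} x≡z = subst (π N ∣_)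
    (trans (cong (λ i → (residue x N - z) * i) π-k)
      (trans (solve 4 (λ x z k k′ → (x :- z) :* k′ := x :* k′ :* con (+ 1) :+ :- z :* k′)
          refl (residue x N) z (π k) (π (k ℕ.+ 0)))
        (cong (λ i → residue x N * i * + 1 + - z * π (k ℕ.+ 0)) (sym π-k))))
    (raise (m ℕ.+ k) N≡ (subst (_ ∣_)
      (solve 3 (λ a b z → (a :- b) :+ (b :- z) := a :- z) refl (residue x N) (residue x (m ℕ.+ k)) z)
      (∣m∣n⇒∣m+n (residue-coherent x (ℕProps.m≤m+n (m ℕ.+ k) _)) x≡z)))
    where
    open ℤSolver.+-*-Solver
    N : ℕ
    N = m ℕ.+ k ℕ.+ (k ℕ.+ 0 ℕ.+ 0)
    N≡ : N ≡ m ℕ.+ k ℕ.+ k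
    N≡ = cong (m ℕ.+ k ℕ.+_) (trans (ℕProps.+-identityʳ (k ℕ.+ 0)) (ℕProps.+-identityʳ k))
    π-k : π k ≡ π (k ℕ.+ 0)
    π-k = cong π (sym (ℕProps.+-identityʳ k))

  ≈ℚₚ-setoid : Setoid 0ℓ 0ℓ
  ≈ℚₚ-setoid = record
    { Carrier = ℚₚ ; _≈_ = _≈ℚₚ_
    ; isEquivalence = record
      { refl  = λ {u} → ≈ℚₚ-refl u
      ; sym   = λ {u} {v} → ≈ℚₚ-sym u v
      ; trans = λ {u} {v} {w} → ≈ℚₚ-trans u v w
      }
    }

  intℤₚ-+ : ∀ i j → (intℤₚ i /p^ 0) +ℚₚ (intℤₚ j /p^ 0) ≈ℚₚ (intℤₚ (i + j) /p^ 0)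
  intℤₚ-+ i j _ = divides (+ 0) (solve 2 (λ i j →
    (i :* con (+ 1) :+ j :* con (+ 1)) :* con (+ 1) :- (i :+ j) :* con (+ 1) := con (+ 0)) refl i j)
    where open ℤSolver.+-*-Solver

  intℤₚ-neg : ∀ i → -ℚₚ (intℤₚ i /p^ 0) ≈ℚₚ (intℤₚ (- i) /p^ 0)
  intℤₚ-neg i _ = divides (+ 0) (ℤProps.+-inverseʳ (- i * + 1))

  -- Over the denominator pᵏ, the subtracted integer is the numerator of ip + ⌊x/pᵏ⌋ₚ. The floor
  -- includes the digit of index k, so it agrees with x modulo pᵏ⁺¹, and ip·pᵏ vanishes there.
  ∣residue-⌊⌋+p : ∀ i x k → π (suc k) ∣ residue x (suc k) - (i * + p * π k + + digitSum x (suc k))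
  ∣residue-⌊⌋+p i x k = subst (π (suc k) ∣_)
    (solve 3 (λ r d m → r :- d :- m := r :- (m :+ d)) refl
      (residue x (suc k)) (+ digitSum x (suc k)) (i * + p * π k))
    (∣m∣n⇒∣m-n (∣residue-digitSum x (suc k))
      (subst (π (suc k) ∣_)
        (trans (cong (i *_) (ℤProps.pos-* p (p ^ k))) (sym (ℤProps.*-assoc i (+ p) (π k))))
        (∣n⇒∣m*n i ∣-refl)))
    where open ℤSolver.+-*-Solver

  -- Here the added integer i contributes i·pᵏ, which vanishes only modulo pᵏ; one power of p is
  -- lost.
  ∣residue-⌊⌋+1 : ∀ i x k → π k ∣ residue x k - (i * + 1 * π k + + digitSum x (suc k))
  ∣residue-⌊⌋+1 i x k = subst (π k ∣_)
    (solve 4 (λ r s d m → s :- d :- (s :- r) :- m := r :- (m :+ d)) refl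
      (residue x k) (residue x (suc k)) (+ digitSum x (suc k)) (i * + 1 * π k))
    (∣m∣n⇒∣m-n
      (∣m∣n⇒∣m-n (∣-trans (π-mono (ℕProps.n≤1+n k)) (∣residue-digitSum x (suc k))) (coherent x k))
      (∣n⇒∣m*n (i * + 1) ∣-refl))
    where open ℤSolver.+-*-Solver

-- The homomorphism ℤ → K, and a ring solver for K.

module IntegerCoefficients {c ℓ} (K : Field c ℓ) where
  open Field K renaming (refl to ≈-refl; sym to ≈-sym; trans to ≈-trans)
  open RingProperties ring
  open import Algebra.Properties.Monoid.Mult +-monoid using (×-homo-+)
  open import Algebra.Properties.Semiring.Mult semiring using (×1-homo-*)
  open RawMonoidDefs +-rawMonoid using () renaming (_×_ to _×ⁿ_)
  open SetoidReasoning setoid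

  fromℤ-⊖ : ∀ m n → fromℤ (m ℤ.⊖ n) ≈ (m ×ⁿ 1#) - (n ×ⁿ 1#)
  fromℤ-⊖ m       zero    = ≈-sym (≈-trans (+-congˡ -0#≈0#) (+-identityʳ _))
  fromℤ-⊖ zero    (suc n) = ≈-sym (+-identityˡ _)
  fromℤ-⊖ (suc m) (suc n) = begin
    fromℤ (suc m ℤ.⊖ suc n)          ≡⟨ cong fromℤ (ℤProps.[1+m]⊖[1+n]≡m⊖n m n) ⟩
    fromℤ (m ℤ.⊖ n)                  ≈⟨ fromℤ-⊖ m n ⟩
    a - b                           ≈⟨ +-congʳ (+-identityˡ a) ⟨
    (0# + a) - b                   ≈⟨ +-congʳ (+-congʳ (-‿inverseʳ 1#)) ⟨
    ((1# - 1#) + a) - b           ≈⟨ +-congʳ (+-assoc 1# (- 1#) a) ⟩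
    (1# + (- 1# + a)) - b        ≈⟨ +-congʳ (+-congˡ (+-comm (- 1#) a)) ⟩
    (1# + (a - 1#)) - b           ≈⟨ +-congʳ (+-assoc 1# a (- 1#)) ⟨
    ((1# + a) - 1#) - b           ≈⟨ +-assoc (1# + a) (- 1#) (- b) ⟩
    (1# + a) + (- 1# - b)        ≈⟨ +-congˡ (-‿+-comm 1# b) ⟩
    (1# + a) - (1# + b)           ∎
    where
    a b : Carrier
    a = m ×ⁿ 1#
    b = n ×ⁿ 1#

  fromℤ-neg : ∀ i → fromℤ (ℤ.- i) ≈ - fromℤ i
  fromℤ-neg (+ zero)  = ≈-sym -0#≈0#
  fromℤ-neg (+ suc n) = ≈-refl
  fromℤ-neg -[1+ n ]  = ≈-sym (-‿involutive _)

  fromℤ-+ : ∀ i j → fromℤ (i ℤ.+ j) ≈ fromℤ i + fromℤ j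
  fromℤ-+ (+ m)    (+ n)    = ×-homo-+ 1# m n
  fromℤ-+ (+ m)    -[1+ n ] = fromℤ-⊖ m (suc n)
  fromℤ-+ -[1+ m ] (+ n)    = ≈-trans (fromℤ-⊖ n (suc m)) (+-comm _ _)
  fromℤ-+ -[1+ m ] -[1+ n ] = begin
    - (suc (suc (m ℕ.+ n)) ×ⁿ 1#)             ≡⟨ cong (λ k → - (k ×ⁿ 1#)) (cong suc (ℕProps.+-suc m n)) ⟨
    - ((suc m ℕ.+ suc n) ×ⁿ 1#)               ≈⟨ -‿cong (×-homo-+ 1# (suc m) (suc n)) ⟩
    - ((suc m ×ⁿ 1#) + (suc n ×ⁿ 1#))        ≈⟨ -‿+-comm _ _ ⟨
    - (suc m ×ⁿ 1#) + - (suc n ×ⁿ 1#)       ∎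

  fromℤ-*-+ : ∀ m j → fromℤ (+ m ℤ.* j) ≈ fromℤ (+ m) * fromℤ j
  fromℤ-*-+ m (+ n)    = begin
    fromℤ (+ m ℤ.* + n)        ≡⟨ cong fromℤ (ℤProps.pos-* m n) ⟨
    fromℤ (+ (m ℕ.* n))      ≈⟨ ×1-homo-* m n ⟩
    fromℤ (+ m) * fromℤ (+ n) ∎
  fromℤ-*-+ m -[1+ n ] = begin
    fromℤ (+ m ℤ.* -[1+ n ])               ≡⟨ cong fromℤ (ℤProps.neg-distribʳ-* (+ m) (+ suc n)) ⟨
    fromℤ (ℤ.- (+ m ℤ.* + suc n))            ≈⟨ fromℤ-neg (+ m ℤ.* + suc n) ⟩
    - fromℤ (+ m ℤ.* + suc n)             ≈⟨ -‿cong (fromℤ-*-+ m (+ suc n)) ⟩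
    - (fromℤ (+ m) * fromℤ (+ suc n))  ≈⟨ -‿distribʳ-* _ _ ⟩
    fromℤ (+ m) * fromℤ -[1+ n ]        ∎

  fromℤ-* : ∀ i j → fromℤ (i ℤ.* j) ≈ fromℤ i * fromℤ j
  fromℤ-* (+ m)    j = fromℤ-*-+ m j
  fromℤ-* -[1+ m ] j = begin
    fromℤ (-[1+ m ] ℤ.* j)             ≡⟨ cong fromℤ (ℤProps.neg-distribˡ-* (+ suc m) j) ⟨
    fromℤ (ℤ.- (+ suc m ℤ.* j))          ≈⟨ fromℤ-neg (+ suc m ℤ.* j) ⟩
    - fromℤ (+ suc m ℤ.* j)           ≈⟨ -‿cong (fromℤ-*-+ (suc m) j) ⟩
    - (fromℤ (+ suc m) * fromℤ j)  ≈⟨ -‿distribˡ-* _ _ ⟩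
    fromℤ -[1+ m ] * fromℤ j        ∎

  almostCommutativeRing : AlmostCommutativeRing c ℓ
  almostCommutativeRing = fromCommutativeRing commutativeRing

  fromℤ-morphism : ℤ.+-*-rawRing -Raw-AlmostCommutative⟶ almostCommutativeRing
  fromℤ-morphism = record
    { ⟦_⟧ = fromℤ ; +-homo = fromℤ-+ ; *-homo = fromℤ-* ; -‿homo = fromℤ-neg
    ; 0-homo = ≈-refl ; 1-homo = +-identityʳ 1# }

  -- Equality in K is not assumed decidable, so the solver compares coefficients in ℤ.
  fromℤ-≟ : ∀ i j → Maybe (fromℤ i ≈ fromℤ j)
  fromℤ-≟ i j = Maybe.map (λ i≡j → reflexive (cong fromℤ i≡j)) (dec⇒maybe (i ℤProps.≟ j))

  module Solver = RingSolver ℤ.+-*-rawRing almostCommutativeRing fromℤ-morphism fromℤ-≟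

-- The valuation that `σₚ` induces on K.

module Convergence
  {c ℓ} {p : ℕ} (p-prime : Prime p) (K : Field c ℓ)
  (σ∞ : Field.Carrier K → ℝ) (σₚ : Field.Carrier K → PAdic.ℚₚ p-prime)
  (σ∞-mono : RingMorphisms.IsRingMonomorphism (Field.rawRing K) ℝ-rawRing σ∞)
  (σₚ-mono : RingMorphisms.IsRingMonomorphism (Field.rawRing K) (PAdic.ℚₚ-rawRing p-prime) σₚ)
  where

  open Field K renaming (refl to ≈-refl; sym to ≈-sym; trans to ≈-trans)
  open RingProperties ring using (-0#≈0#)
  open RawMonoidDefs +-rawMonoid using () renaming (_×_ to _×ⁿ_)
  open PAdic p-prime
  open Valuation p-prime
  open Algorithm p-prime K σ∞ σₚ σ∞-mono
  open IntegerCoefficients K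
  open Solver using (solve; con; _:=_; _:+_; _:*_; _:-_; :-_)
  private
    module σₚ = RingMorphisms.IsRingMonomorphism σₚ-mono

  infix 4 _∈𝔭^_
  -- 𝔭 is the maximal ideal of the valuation ring that `σₚ` induces on K.
  _∈𝔭^_ : Carrier → ℕ → Set
  x ∈𝔭^ m = σₚ x ∈p^ m

  ∈𝔭^-resp-≈ : ∀ {x y m} → x ≈ y → x ∈𝔭^ m → y ∈𝔭^ m
  ∈𝔭^-resp-≈ {x} {y} x≈y = ∈p^-resp-≈ (σₚ x) (σₚ y) (σₚ.⟦⟧-cong x≈y)

  ∈𝔭^-weaken : ∀ {x m n} → m ℕ.≤ n → x ∈𝔭^ n → x ∈𝔭^ m
  ∈𝔭^-weaken {x} = ∈p^-weaken {σₚ x}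

  ∈𝔭^-+ : ∀ {x y m} → x ∈𝔭^ m → y ∈𝔭^ m → x + y ∈𝔭^ m
  ∈𝔭^-+ {x} {y} {m} x∈ y∈ = ∈p^-resp-≈ (σₚ x +ℚₚ σₚ y) (σₚ (x + y))
    (≈ℚₚ-sym (σₚ (x + y)) (σₚ x +ℚₚ σₚ y) (σₚ.+-homo x y)) (∈p^-+ {σₚ x} {σₚ y} {m} x∈ y∈)

  ∈𝔭^-neg : ∀ {x m} → x ∈𝔭^ m → - x ∈𝔭^ m
  ∈𝔭^-neg {x} {m} x∈ = ∈p^-resp-≈ (-ℚₚ σₚ x) (σₚ (- x))
    (≈ℚₚ-sym (σₚ (- x)) (-ℚₚ σₚ x) (σₚ.-‿homo x)) (∈p^-neg {σₚ x} {m} x∈)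

  ∈𝔭^-- : ∀ {x y m} → x ∈𝔭^ m → y ∈𝔭^ m → x - y ∈𝔭^ m
  ∈𝔭^-- {x} {y} x∈ y∈ = ∈𝔭^-+ {x} { - y } x∈ (∈𝔭^-neg {y} y∈)

  ∈𝔭^-* : ∀ {x y m n} → x ∈𝔭^ m → y ∈𝔭^ n → x * y ∈𝔭^ (m ℕ.+ n)
  ∈𝔭^-* {x} {y} {m} {n} x∈ y∈ = ∈p^-resp-≈ (σₚ x *ℚₚ σₚ y) (σₚ (x * y))
    (≈ℚₚ-sym (σₚ (x * y)) (σₚ x *ℚₚ σₚ y) (σₚ.*-homo x y)) (∈p^-* {σₚ x} {σₚ y} {m} {n} x∈ y∈)

  0∈𝔭^ : ∀ {m} → 0# ∈𝔭^ m
  0∈𝔭^ {m} = ∈p^-resp-≈ (intℤₚ (+ 0) /p^ 0) (σₚ 0#)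
    (≈ℚₚ-sym (σₚ 0#) (intℤₚ (+ 0) /p^ 0) σₚ.0#-homo) (integer∈p^ {+ 0} {m} (divides (+ 0) refl))

  1∈𝔭^0 : 1# ∈𝔭^ 0
  1∈𝔭^0 = ∈p^-resp-≈ (intℤₚ (+ 1) /p^ 0) (σₚ 1#)
    (≈ℚₚ-sym (σₚ 1#) (intℤₚ (+ 1) /p^ 0) σₚ.1#-homo) (integer∈p^ {+ 1} {0} ∣-refl)

  1∉𝔭 : ¬ (1# ∈𝔭^ 1)
  1∉𝔭 1∈ = 1∉p^1 (∈p^-resp-≈ (σₚ 1#) (intℤₚ (+ 1) /p^ 0) σₚ.1#-homo 1∈)

  -- The bound k is the exponent in the given representation of `σₚ u`, which need not be reduced;
  -- any bound serves for the cancellation of elements of 1 + 𝔭.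
  bounded-denominator : ∀ u → ∃ λ k → ∀ {x m} → x ∈𝔭^ (m ℕ.+ k) → u * x ∈𝔭^ m
  bounded-denominator u = ℚₚ.exponent (σₚ u) , λ {x} {m} x∈ →
    ∈p^-resp-≈ (σₚ u *ℚₚ σₚ x) (σₚ (u * x))
      (≈ℚₚ-sym (σₚ (u * x)) (σₚ u *ℚₚ σₚ x) (σₚ.*-homo u x)) (∈p^-*-bounded {σₚ u} {σₚ x} {m} x∈)

  1+𝔭≉0 : ∀ {x} → x - 1# ∈𝔭^ 1 → ¬ (x ≈ 0#)
  1+𝔭≉0 {x} x-1∈ x≈0 = 1∉𝔭 (∈𝔭^-resp-≈
    (≈-trans (-‿cong (≈-trans (+-congʳ x≈0) (+-identityˡ (- 1#))))
      -- The unit enters as a variable `o`, since `con (+ 1)` denotes `1# + 0#`, which is only ≈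
      -- `1#`.
      (solve 1 (λ o → :- :- o := o) ≈-refl 1#))
    (∈𝔭^-neg {x - 1#} {1} x-1∈))

  1+𝔭⇒integral : ∀ {x} → x - 1# ∈𝔭^ 1 → x ∈𝔭^ 0
  1+𝔭⇒integral {x} x-1∈ = ∈𝔭^-resp-≈ (solve 2 (λ x o → (x :- o) :+ o := x) ≈-refl x 1#)
    (∈𝔭^-+ {x - 1#} {1#} {0} (∈𝔭^-weaken {x - 1#} ℕ.z≤n x-1∈) 1∈𝔭^0)

  -- With w = 1 - x, u = u x (1 + w + ⋯ + w^(j-1)) + u wʲ, and u wʲ ∈ 𝔭ᵐ for large j.
  cancel-1+𝔭 : ∀ {u x m} → x - 1# ∈𝔭^ 1 → u * x ∈𝔭^ m → u ∈𝔭^ m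
  cancel-1+𝔭 {u} {x} {m} x-1∈ ux∈ = ∈𝔭^-resp-≈ (*-identityʳ u) (descend 0 (m ℕ.+ k) 1# 1∈𝔭^0 refl)
    where
    open SetoidReasoning setoid
    k : ℕ
    k = proj₁ (bounded-denominator u)
    -- `z` stands for (x - 1)ⁱ, which is wⁱ up to sign, and `j` counts the factors missing until the
    -- exponent m + k, where the denominator of u is absorbed. Each step uses uz = uxz - uz(x - 1).
    descend : ∀ i j z → z ∈𝔭^ i → i ℕ.+ j ≡ m ℕ.+ k → u * z ∈𝔭^ m
    descend i zero    z z∈ i≡ = proj₂ (bounded-denominator u) {z} {m}
      (subst (z ∈𝔭^_) (trans (sym (ℕProps.+-identityʳ i)) i≡) z∈)
    descend i (suc j) z z∈ i≡ = ∈𝔭^-resp-≈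
      (begin
        u * x * z - u * (z * (x - 1#))
          ≈⟨ solve 4 (λ u x z o → u :* x :* z :- u :* (z :* (x :- o)) := u :* z :* o) ≈-refl u x z 1# ⟩
        u * z * 1#
          ≈⟨ *-identityʳ (u * z) ⟩
        u * z ∎)
      (∈𝔭^-- {u * x * z} {u * (z * (x - 1#))} {m}
        (∈𝔭^-weaken {u * x * z} (ℕProps.m≤m+n m i) (∈𝔭^-* {u * x} {z} {m} {i} ux∈ z∈))
        (descend (i ℕ.+ 1) j (z * (x - 1#)) (∈𝔭^-* {z} {x - 1#} {i} {1} z∈ x-1∈)
          (trans (ℕProps.+-assoc i 1 j) i≡)))

  -- Integers and rationals in K, and the valuation of 1/α - a^(ε)(α).

  σₚ-× : ∀ n → σₚ (n ×ⁿ 1#) ≈ℚₚ (intℤₚ (+ n) /p^ 0)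
  σₚ-× zero    = σₚ.0#-homo
  σₚ-× (suc n) = begin
    σₚ (1# + n ×ⁿ 1#)                            ≈⟨ σₚ.+-homo 1# (n ×ⁿ 1#) ⟩
    σₚ 1# +ℚₚ σₚ (n ×ⁿ 1#)                       ≈⟨ +ℚₚ-cong (σₚ 1#) 1ₚ (σₚ (n ×ⁿ 1#)) nₚ σₚ.1#-homo (σₚ-× n) ⟩
    1ₚ +ℚₚ nₚ                                    ≈⟨ intℤₚ-+ (+ 1) (+ n) ⟩
    intℤₚ (+ suc n) /p^ 0                        ∎
    where
    open SetoidReasoning ≈ℚₚ-setoid
    1ₚ nₚ : ℚₚ
    1ₚ = intℤₚ (+ 1) /p^ 0
    nₚ = intℤₚ (+ n) /p^ 0

  σₚ-ℤ : ∀ i → σₚ (fromℤ i) ≈ℚₚ (intℤₚ i /p^ 0)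
  σₚ-ℤ (+ n)    = σₚ-× n
  σₚ-ℤ -[1+ n ] = begin
    σₚ (- (suc n ×ⁿ 1#))           ≈⟨ σₚ.-‿homo (suc n ×ⁿ 1#) ⟩
    -ℚₚ σₚ (suc n ×ⁿ 1#)           ≈⟨ -ℚₚ-cong (σₚ (suc n ×ⁿ 1#)) (intℤₚ (+ suc n) /p^ 0) (σₚ-× (suc n)) ⟩
    -ℚₚ (intℤₚ (+ suc n) /p^ 0)    ≈⟨ intℤₚ-neg (+ suc n) ⟩
    intℤₚ -[1+ n ] /p^ 0           ∎
    where open SetoidReasoning ≈ℚₚ-setoid

  ι-fraction : ∀ q → ι q * fromℤ (ℚ.↧ q) ≈ fromℤ (ℚ.↥ q)
  ι-fraction (mkℚᵘ n d) = begin
    fromℤ n * inv (fromℤ (+ suc d)) (characteristic-zero d) * fromℤ (+ suc d)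
      ≈⟨ solve 3 (λ n i d → n :* i :* d := n :* (d :* i)) ≈-refl _ _ _ ⟩
    fromℤ n * (fromℤ (+ suc d) * inv (fromℤ (+ suc d)) (characteristic-zero d))
      ≈⟨ *-congˡ (proj₂ (invertible (fromℤ (+ suc d)) (characteristic-zero d))) ⟩
    fromℤ n * 1#
      ≈⟨ *-identityʳ (fromℤ n) ⟩
    fromℤ n ∎
    where open SetoidReasoning setoid

  -- Rationals are unnormalised: the sum has numerator i·d + z·1 and denominator 1·d, with no common
  -- factor cancelled.
  ι-sum : ∀ i z d .{{_ : NonZero d}} → ι (i / 1 ℚ.+ z / d) * fromℤ (+ d) ≈ fromℤ (i ℤ.* + d ℤ.+ z)
  ι-sum i z (suc d) = begin
    ι q * fromℤ (+ suc d)   ≡⟨ cong (λ k → ι q * fromℤ (+ suc k)) (ℕProps.+-identityʳ d) ⟨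
    ι q * fromℤ (ℚ.↧ q)     ≈⟨ ι-fraction q ⟩
    fromℤ (ℚ.↥ q)           ≡⟨ cong (λ k → fromℤ (i ℤ.* + suc d ℤ.+ k)) (ℤProps.*-identityʳ z) ⟩
    fromℤ (i ℤ.* + suc d ℤ.+ z) ∎
    where
    open SetoidReasoning setoid
    q : ℚᵘ
    q = i / 1 ℚ.+ z / suc d

  remainder-valuation : Parity → ℕ
  remainder-valuation 0ℙ = 1
  remainder-valuation 1ℙ = 0

  ∣residue-numerator : ∀ ε i x k → let m = remainder-valuation ε in
    π (m ℕ.+ k) ∣ residue x (m ℕ.+ k) ℤ.- (i ℤ.* + spacing ε ℤ.* π k ℤ.+ + digitSum x (suc k))
  ∣residue-numerator 0ℙ = ∣residue-⌊⌋+p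
  ∣residue-numerator 1ℙ = ∣residue-⌊⌋+1

  -- Multiplied by pᵏ, with k the exponent of `σₚ u`, the subtracted rational becomes the integer z,
  -- which agrees with the mantissa modulo p^(m+k). Removing pᵏ leaves valuation at least m.
  fractional-part : ∀ u ε i → u - ι (i ℤ.* + spacing ε / 1 ℚ.+ ⌊ σₚ u ⌋ₚ) ∈𝔭^ remainder-valuation ε
  fractional-part u ε i = u*pᵏ∈p^⇒u∈p^ (σₚ b) {k} {m}
    (∈p^-resp-≈ (σₚ u *ℚₚ pᵏ -ℚₚ zₚ) (σₚ b *ℚₚ pᵏ) {m ℕ.+ k} eq
      (pᵏ*-approximation x k {z} {m} (∣residue-numerator ε i x k)))
    where
    x : ℤₚ
    x = ℚₚ.mantissa (σₚ u)
    k m : ℕ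
    k = ℚₚ.exponent (σₚ u)
    m = remainder-valuation ε
    z : ℤ
    z = i ℤ.* + spacing ε ℤ.* π k ℤ.+ + digitSum x (suc k)
    pᵏ zₚ : ℚₚ
    pᵏ = intℤₚ (π k) /p^ 0
    zₚ = intℤₚ z /p^ 0
    P Z a b : Carrier
    P = fromℤ (π k)
    Z = fromℤ z
    a = ι (i ℤ.* + spacing ε / 1 ℚ.+ ⌊ σₚ u ⌋ₚ)
    b = u - a
    bP≈ : u * P - Z ≈ b * P
    bP≈ = begin
      u * P - Z     ≈⟨ +-congˡ (-‿cong (ι-sum (i ℤ.* + spacing ε) (+ digitSum x (suc k)) (p ^ k) {{p^≢0 k}})) ⟨
      u * P - a * P ≈⟨ solve 3 (λ u a p → u :* p :- a :* p := (u :- a) :* p) ≈-refl u a P ⟩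
      b * P         ∎
      where open SetoidReasoning setoid
    -- The passage between ℚₚ and K goes through a·pᵏ = z, because the image under `σₚ` is known
    -- explicitly for integers.
    eq : σₚ u *ℚₚ pᵏ -ℚₚ zₚ ≈ℚₚ σₚ b *ℚₚ pᵏ
    eq = begin
      σₚ u *ℚₚ pᵏ -ℚₚ zₚ
        ≈⟨ +ℚₚ-cong (σₚ u *ℚₚ σₚ P) (σₚ u *ℚₚ pᵏ) (-ℚₚ σₚ Z) (-ℚₚ zₚ)
             (*ℚₚ-cong (σₚ u) (σₚ u) (σₚ P) pᵏ (≈ℚₚ-refl (σₚ u)) (σₚ-ℤ (π k)))
             (-ℚₚ-cong (σₚ Z) zₚ (σₚ-ℤ z)) ⟨
      σₚ u *ℚₚ σₚ P -ℚₚ σₚ Z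
        ≈⟨ +ℚₚ-cong (σₚ (u * P)) (σₚ u *ℚₚ σₚ P) (σₚ (- Z)) (-ℚₚ σₚ Z) (σₚ.*-homo u P) (σₚ.-‿homo Z) ⟨
      σₚ (u * P) +ℚₚ σₚ (- Z)
        ≈⟨ σₚ.+-homo (u * P) (- Z) ⟨
      σₚ (u * P - Z)
        ≈⟨ σₚ.⟦⟧-cong bP≈ ⟩
      σₚ (b * P)
        ≈⟨ σₚ.*-homo b P ⟩
      σₚ b *ℚₚ σₚ P
        ≈⟨ *ℚₚ-cong (σₚ b) (σₚ b) (σₚ P) pᵏ (≈ℚₚ-refl (σₚ b)) (σₚ-ℤ (π k)) ⟩
      σₚ b *ℚₚ pᵏ ∎
      where open SetoidReasoning ≈ℚₚ-setoid

  within-pred : ∀ L n → suc n within L → n within L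
  within-pred (finite N) n = ℕProps.≤-trans (ℕProps.n≤1+n n)
  within-pred infinite   _ _ = tt

  remainder-valuation-suc : ∀ n →
    remainder-valuation (parity n) ℕ.+ remainder-valuation (parity (suc n)) ≡ 1
  remainder-valuation-suc zero          = refl
  remainder-valuation-suc (suc zero)    = refl
  remainder-valuation-suc (suc (suc n)) = remainder-valuation-suc n

  -- States, errors and denominators along one execution.

  module Execution {α : Carrier} {L : Length} (r : Run α L) (α∈𝔭 : α ∈𝔭^ 1) where
    open Run r hiding (stop) renaming (state to x; quotient to a; start to x₁≈α)

    module Step (n : ℕ) (n<L : suc n within L) where
      1/x : Carrier
      1/x = inv (x (suc n)) (nonzero (suc n) (ℕ.s≤s ℕ.z≤n) n<L)

      x*1/x : x (suc n) * 1/x ≈ 1#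
      x*1/x = proj₂ (invertible (x (suc n)) (nonzero (suc n) (ℕ.s≤s ℕ.z≤n) n<L))

      x-next : x (suc (suc n)) ≈ 1/x - a (suc n)
      x-next = next (suc n) (ℕ.s≤s ℕ.z≤n) n<L

      x-next∈ : x (suc (suc n)) ∈𝔭^ remainder-valuation (parity (suc n))
      x-next∈ = ∈𝔭^-resp-≈
        (≈-sym (≈-trans x-next (+-congˡ (-‿cong (proj₂ (proj₂ selected))))))
        (fractional-part 1/x (parity (suc n)) (proj₁ selected))
        where
        selected : IsPartialQuotient (parity (suc n)) (x (suc n)) _ (a (suc n))
        selected = select (suc n) (ℕ.s≤s ℕ.z≤n) n<L

    x∈ : ∀ n → n within L → x (suc n) ∈𝔭^ remainder-valuation (parity n)
    -- State n + 1 takes its bound from the parity of the step n that produced it. State 1 comes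
    -- from no step, but parity 0 is even and asks for just the vₚ(α) ≥ 1 of property I.
    x∈ zero    _   = ∈𝔭^-resp-≈ (≈-sym x₁≈α) α∈𝔭
    x∈ (suc n) n<L = Step.x-next∈ n n<L

    x∈𝔭^0 : ∀ n → n within L → x (suc n) ∈𝔭^ 0
    x∈𝔭^0 n n≤L = ∈𝔭^-weaken {x (suc n)} ℕ.z≤n (x∈ n n≤L)

    -- Of two consecutive states one has odd index and lies in 𝔭, while the other is integral.
    xx∈𝔭 : ∀ n → suc n within L → x (suc n) * x (suc (suc n)) ∈𝔭^ 1
    xx∈𝔭 n n<L = subst (x (suc n) * x (suc (suc n)) ∈𝔭^_) (remainder-valuation-suc n)
      (∈𝔭^-* {x (suc n)} {x (suc (suc n))} {remainder-valuation (parity n)}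
        (x∈ n (within-pred L n n<L)) (x∈ (suc n) n<L))

    -- num′ n = pₙ₋₁ and den′ n = qₙ₋₁, with p₋₁ = 1 and q₋₁ = 0.
    num′ den′ num den : ℕ → Carrier
    num′ n = e₁₁ (convergentMatrix a n)
    den′ n = e₂₁ (convergentMatrix a n)
    num n  = pₙ a n
    den n  = qₙ a n

    -- A row (u, v) times the matrix of a partial quotient a is (v, u + va); this lemma and the next
    -- are its two entries.
    old-column : ∀ u v → u * 0# + v * 1# ≈ v
    old-column u v = ≈-trans (+-cong (zeroʳ u) (*-identityʳ v)) (+-identityˡ v)

    new-column : ∀ u v a → u * 1# + v * a ≈ u + v * a
    new-column u v a = +-congʳ (*-identityʳ u)

    error error′ : ℕ → Carrier
    error  n = den n * α - num n
    error′ n = den′ n * α - num′ n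

    error′-suc : ∀ n → error′ (suc n) ≈ error n
    error′-suc n = +-cong (*-congʳ (old-column (den′ n) (den n))) (-‿cong (old-column (num′ n) (num n)))

    -- By induction: in error (n+1) = error′ n + aₙ₊₁·error n, the hypothesis solved for error′ n
    -- gives -(1/xₙ₊₁)·error n, and 1/xₙ₊₁ - aₙ₊₁ is xₙ₊₂.
    error-recurrence : ∀ n → n within L → error n ≈ - (x (suc n) * error′ n)
    error-recurrence zero _ = begin
      1# * α - 0#
        ≈⟨ solve 2 (λ α o → o :* α :- con (+ 0) := :- (α :* (con (+ 0) :* α :- o))) ≈-refl α 1# ⟩
      - (α * (0# * α - 1#))
        ≈⟨ -‿cong (*-congʳ x₁≈α) ⟨
      - (x 1 * (0# * α - 1#)) ∎
      where open SetoidReasoning setoid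
    error-recurrence (suc n) n<L = begin
      den (suc n) * α - num (suc n)
        ≈⟨ +-cong (*-congʳ (new-column (den′ n) (den n) b)) (-‿cong (new-column (num′ n) (num n) b)) ⟩
      (den′ n + den n * b) * α - (num′ n + num n * b)
        ≈⟨ solve 6 (λ α b p q p′ q′ → (q′ :+ q :* b) :* α :- (p′ :+ p :* b)
                                   := (q′ :* α :- p′) :+ (q :* α :- p) :* b)
             ≈-refl α b (num n) (den n) (num′ n) (den′ n) ⟩
      error′ n + error n * b
        ≈⟨ +-congʳ (*-identityˡ (error′ n)) ⟨
      1# * error′ n + error n * b
        ≈⟨ +-congʳ (*-congʳ x*1/x) ⟨
      x (suc n) * 1/x * error′ n + error n * b
        ≈⟨ solve 5 (λ x y f e b → x :* y :* f :+ e :* b := :- (y :* :- (x :* f)) :+ e :* b)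
             ≈-refl (x (suc n)) 1/x (error′ n) (error n) b ⟩
      - (1/x * - (x (suc n) * error′ n)) + error n * b
        ≈⟨ +-congʳ (-‿cong (*-congˡ (error-recurrence n (within-pred L n n<L)))) ⟨
      - (1/x * error n) + error n * b
        ≈⟨ solve 3 (λ y e b → :- (y :* e) :+ e :* b := :- ((y :- b) :* e)) ≈-refl 1/x (error n) b ⟩
      - ((1/x - b) * error n)
        ≈⟨ -‿cong (*-cong x-next (error′-suc n)) ⟨
      - (x (suc (suc n)) * error′ (suc n)) ∎
      where
      open SetoidReasoning setoid
      open Step n n<L
      b : Carrier
      b = a (suc n)

    -- The errors start from error′ 0 = -1, and each step multiplies by an integral state, up to
    -- sign.
    error∈𝔭^0 : ∀ n → n within L → error n ∈𝔭^ 0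
    error∈𝔭^0 n n≤L = ∈𝔭^-resp-≈ (≈-sym (error-recurrence n n≤L))
      (∈𝔭^-neg {x (suc n) * error′ n} {0} (∈𝔭^-* {x (suc n)} {error′ n} {0} {0} (x∈𝔭^0 n n≤L) (error′∈ n n≤L)))
      where
      error′∈ : ∀ n → n within L → error′ n ∈𝔭^ 0
      error′∈ zero    _   = ∈𝔭^-resp-≈
        (≈-sym (≈-trans (+-congʳ (zeroˡ α)) (+-identityˡ (- 1#)))) (∈𝔭^-neg {1#} {0} 1∈𝔭^0)
      error′∈ (suc n) n<L = ∈𝔭^-resp-≈ (≈-sym (error′-suc n)) (error∈𝔭^0 n (within-pred L n n<L))

    xs : ℕ → Carrier
    xs zero    = 1#
    xs (suc n) = xs n * x (suc n)

    -- The factors are grouped in consecutive pairs from the end, each contributing one power of p;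
    -- a leftover x₁ is counted only as integral.
    xs∈ : ∀ n → n within L → xs n ∈𝔭^ ℕ.⌊ n /2⌋
    xs∈ zero          _   = 1∈𝔭^0
    xs∈ (suc zero)    1≤L = ∈𝔭^-* {1#} {x 1} {0} {0} 1∈𝔭^0 (x∈𝔭^0 0 (within-pred L 0 1≤L))
    xs∈ (suc (suc n)) n≤L = subst (xs (suc (suc n)) ∈𝔭^_) (ℕProps.+-comm ℕ.⌊ n /2⌋ 1)
      (∈𝔭^-resp-≈ (≈-sym (*-assoc (xs n) (x (suc n)) (x (suc (suc n)))))
        (∈𝔭^-* {xs n} {x (suc n) * x (suc (suc n))} {ℕ.⌊ n /2⌋} {1}
          (xs∈ n (within-pred L n n<L)) (xx∈𝔭 n n<L)))
      where
      n<L : suc n within L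
      n<L = within-pred L (suc n) n≤L

    unit : ℕ → Carrier
    unit n = den n * xs n

    -- Mutual induction with `den′xsx∈𝔭`: in Uₙ₊₁ - 1 = qₙ₋₁x₁⋯xₙ₊₁ + (Uₙ - 1) - Uₙxₙ₊₁xₙ₊₂ every
    -- summand lies in 𝔭.
    unit-1∈𝔭 : ∀ n → n within L → unit n - 1# ∈𝔭^ 1
    -- For n ≥ 1 the product is Uₙ₋₁xₙxₙ₊₁ with Uₙ₋₁ integral; for n = 0 it vanishes with q₋₁.
    den′xsx∈𝔭 : ∀ n → n within L → den′ n * (xs n * x (suc n)) ∈𝔭^ 1

    unit-1∈𝔭 zero    _   = ∈𝔭^-resp-≈
      (≈-sym (≈-trans (+-congʳ (*-identityˡ 1#)) (-‿inverseʳ 1#))) (0∈𝔭^ {1})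
    unit-1∈𝔭 (suc n) n<L = ∈𝔭^-resp-≈ (≈-sym expand)
      (∈𝔭^-- {den′ n * xs (suc n) + (unit n - 1#)} {unit n * xx} {1}
        (∈𝔭^-+ {den′ n * xs (suc n)} {unit n - 1#} {1} (den′xsx∈𝔭 n n≤L) (unit-1∈𝔭 n n≤L))
        (∈𝔭^-* {unit n} {xx} {0} {1} (1+𝔭⇒integral {unit n} (unit-1∈𝔭 n n≤L)) (xx∈𝔭 n n<L)))
      where
      open SetoidReasoning setoid
      open Step n n<L
      n≤L : n within L
      n≤L = within-pred L n n<L
      b xx : Carrier
      b = a (suc n)
      xx = x (suc n) * x (suc (suc n))
      expand : unit (suc n) - 1# ≈ den′ n * xs (suc n) + (unit n - 1#) - unit n * xx
      expand = begin
        den (suc n) * xs (suc n) - 1#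
          ≈⟨ +-congʳ (*-congʳ (new-column (den′ n) (den n) b)) ⟩
        (den′ n + den n * b) * (xs n * x (suc n)) - 1#
          ≈⟨ solve 7 (λ q q′ b s x y o →
               (q′ :+ q :* b) :* (s :* x) :- o :=
               q′ :* (s :* x) :+ (q :* s :* (x :* y) :- o) :- q :* s :* (x :* (y :- b)))
               ≈-refl (den n) (den′ n) b (xs n) (x (suc n)) 1/x 1# ⟩
        den′ n * xs (suc n) + (unit n * (x (suc n) * 1/x) - 1#) - unit n * (x (suc n) * (1/x - b))
          ≈⟨ +-cong (+-congˡ (+-congʳ (≈-trans (*-congˡ x*1/x) (*-identityʳ (unit n)))))
                    (-‿cong (*-congˡ (*-congˡ (≈-sym x-next)))) ⟩
        den′ n * xs (suc n) + (unit n - 1#) - unit n * xx ∎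

    den′xsx∈𝔭 zero    _   = ∈𝔭^-resp-≈ (≈-sym (zeroˡ (1# * x 1))) (0∈𝔭^ {1})
    den′xsx∈𝔭 (suc n) n<L = ∈𝔭^-resp-≈
      (begin
        unit n * (x (suc n) * x (suc (suc n)))
          ≈⟨ solve 4 (λ q s x y → q :* s :* (x :* y) := q :* (s :* x :* y))
               ≈-refl (den n) (xs n) (x (suc n)) (x (suc (suc n))) ⟩
        den n * (xs (suc n) * x (suc (suc n)))
          ≈⟨ *-congʳ (old-column (den′ n) (den n)) ⟨
        den′ (suc n) * (xs (suc n) * x (suc (suc n))) ∎)
      (∈𝔭^-* {unit n} {x (suc n) * x (suc (suc n))} {0} {1}
        (1+𝔭⇒integral {unit n} (unit-1∈𝔭 n (within-pred L n n<L))) (xx∈𝔭 n n<L))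
      where open SetoidReasoning setoid

    den≉0 : ∀ n → n within L → ¬ (den n ≈ 0#)
    den≉0 n n≤L q≈0 = 1+𝔭≉0 {unit n} (unit-1∈𝔭 n n≤L) (≈-trans (*-congʳ q≈0) (zeroˡ (xs n)))

    convergent : ∀ n → n within L → Carrier
    convergent n n≤L = num n * inv (den n) (den≉0 n n≤L)

    convergent*den : ∀ n n≤L → convergent n n≤L * den n ≈ num n
    convergent*den n n≤L = begin
      num n * 1/q * den n     ≈⟨ solve 3 (λ p i q → p :* i :* q := p :* (q :* i)) ≈-refl (num n) 1/q (den n) ⟩
      num n * (den n * 1/q)   ≈⟨ *-congˡ (proj₂ (invertible (den n) (den≉0 n n≤L))) ⟩
      num n * 1#            ≈⟨ *-identityʳ (num n) ⟩
      num n                 ∎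
      where
      open SetoidReasoning setoid
      1/q : Carrier
      1/q = inv (den n) (den≉0 n n≤L)

    -- Multiplying by Uₙ clears the denominator qₙ, and as Uₙ ≡ 1 modulo p, cancelling it afterwards
    -- costs no power of p.
    convergent-α∈ : ∀ n n≤L → convergent n n≤L - α ∈𝔭^ ℕ.⌊ n /2⌋
    convergent-α∈ n n≤L = cancel-1+𝔭 {convergent n n≤L - α} {unit n} {ℕ.⌊ n /2⌋} (unit-1∈𝔭 n n≤L)
      (∈𝔭^-resp-≈ (≈-sym eq) (∈𝔭^-neg {error n * xs n} {ℕ.⌊ n /2⌋}
        (∈𝔭^-* {error n} {xs n} {0} (error∈𝔭^0 n n≤L) (xs∈ n n≤L))))
      where
      open SetoidReasoning setoid
      pq : Carrier
      pq = convergent n n≤L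
      eq : (pq - α) * unit n ≈ - (error n * xs n)
      eq = begin
        (pq - α) * (den n * xs n)
          ≈⟨ solve 4 (λ c α q s → (c :- α) :* (q :* s) := :- ((q :* α :- c :* q) :* s)) ≈-refl pq α (den n) (xs n) ⟩
        - ((den n * α - pq * den n) * xs n)
          ≈⟨ -‿cong (*-congʳ (+-congˡ (-‿cong (convergent*den n n≤L)))) ⟩
        - (error n * xs n) ∎

  -- The limit of the convergents.

  ∈𝔭^⇒v≥ : ∀ x y {m} → x - y ∈𝔭^ m → v[ σₚ x -ℚₚ σₚ y ]≥ m
  ∈𝔭^⇒v≥ x y {m} x-y∈ = ∈p^⇒v≥ {σₚ x -ℚₚ σₚ y} {m}
    (∈p^-resp-≈ (σₚ (x - y)) (σₚ x -ℚₚ σₚ y) {m} (begin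
      σₚ (x - y)           ≈⟨ σₚ.+-homo x (- y) ⟩
      σₚ x +ℚₚ σₚ (- y)    ≈⟨ +ℚₚ-cong (σₚ x) (σₚ x) (σₚ (- y)) (-ℚₚ σₚ y) (≈ℚₚ-refl (σₚ x)) (σₚ.-‿homo y) ⟩
      σₚ x -ℚₚ σₚ y        ∎) x-y∈)
    where open SetoidReasoning ≈ℚₚ-setoid

  -- The last error is a multiple of the state after step N, which is zero when the algorithm stops
  -- there.
  last-convergent : ∀ {α N} (r : Run α (finite N)) (α∈𝔭 : α ∈𝔭^ 1) →
                    Execution.convergent r α∈𝔭 N ℕProps.≤-refl ≈ α
  last-convergent {α} {N} r α∈𝔭 = begin
    num N * 1/q                ≈⟨ *-congʳ p≈ ⟩
    den N * α * 1/q            ≈⟨ solve 3 (λ q α i → q :* α :* i := q :* i :* α) ≈-refl (den N) α 1/q ⟩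
    den N * 1/q * α            ≈⟨ *-congʳ (proj₂ (invertible (den N) (den≉0 N ℕProps.≤-refl))) ⟩
    1# * α                   ≈⟨ *-identityˡ α ⟩
    α                        ∎
    where
    open SetoidReasoning setoid
    open Execution r α∈𝔭
    1/q : Carrier
    1/q = inv (den N) (den≉0 N ℕProps.≤-refl)
    error≈0 : error N ≈ 0#
    error≈0 = begin
      error N                           ≈⟨ error-recurrence N ℕProps.≤-refl ⟩
      - (Run.state r (suc N) * error′ N) ≈⟨ -‿cong (≈-trans (*-congʳ (Run.stop r N refl)) (zeroˡ (error′ N))) ⟩
      - 0#                              ≈⟨ -0#≈0# ⟩
      0#                                ∎
    p≈ : num N ≈ den N * α
    p≈ = begin
      num N                ≈⟨ solve 2 (λ p e → p := (e :- (e :- p))) ≈-refl (num N) (den N * α) ⟩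
      den N * α - error N  ≈⟨ +-congˡ (≈-trans (-‿cong error≈0) -0#≈0#) ⟩
      den N * α + 0#       ≈⟨ +-identityʳ (den N * α) ⟩
      den N * α            ∎

  convergentsTendTo : ∀ α → α ∈𝔭^ 1 → (L : Length) (r : Run α L) → ConvergentsTendTo r (σₚ α)
  convergentsTendTo α α∈𝔭 (finite N) r =
    Execution.den≉0 r α∈𝔭 , σₚ.⟦⟧-cong (last-convergent r α∈𝔭)
  -- The bound ⌊n/2⌋ on the valuation gains one every two steps, so it reaches m from n = 2m on.
  convergentsTendTo α α∈𝔭 infinite r = den≉0 , λ m → m ℕ.+ m , λ n 2m≤n →
    ∈𝔭^⇒v≥ (convergent n tt) α {m} (∈𝔭^-weaken {convergent n tt - α}
      (ℕProps.≤-trans (ℕProps.≤-reflexive (ℕProps.n≡⌊n+n/2⌋ m)) (ℕProps.⌊n/2⌋-mono 2m≤n))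
      (convergent-α∈ n tt))
    where open Execution r α∈𝔭

theorem2p12 : ∀ {c ℓ} (p : ℕ) (p-prime : Prime p) (K : Field c ℓ)
    (σ∞ : Field.Carrier K → ℝ) (σₚ : Field.Carrier K → PAdic.ℚₚ p-prime)
    (σ∞-mono : RingMorphisms.IsRingMonomorphism (Field.rawRing K) ℝ-rawRing σ∞)
    (σₚ-mono : RingMorphisms.IsRingMonomorphism (Field.rawRing K) (PAdic.ℚₚ-rawRing p-prime) σₚ) →
    let open Algorithm p-prime K σ∞ σₚ σ∞-mono in
    (α : Field.Carrier K) → PropertyI α →
    (L : Length) (r : Run α L) → ConvergentsTendTo r (σₚ α)
theorem2p12 p p-prime K σ∞ σₚ σ∞-mono σₚ-mono α (_ , v≥1) =
  Convergence.convergentsTendTo p-prime K σ∞ σₚ σ∞-mono σₚ-mono α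
    (Valuation.v≥⇒∈p^ p-prime {σₚ α} {1} v≥1)
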